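{- If $G$ is a super-minimally $3$-connected graph, then $|E(G)|\le 2|V(G)|-2$. Moreover, equality holds if and only if $G$ is a wheel with at least three spokes.
   Context: All graphs are finite and simple. A graph is $k$-connected if it has more than $k$ vertices and no vertex cut of size less than $k$. A graph $G$ is super-minimally $k$-connected if $G$ is $k$-connected but no proper subgraph of $G$ is $k$-connected. A wheel with $n$ spokes is obtained from a cycle on $n$ vertices (the rim) by adding a new vertex (the hub) adjacent to every rim vertex. -}

module Defs where

open import Data.Nat using (ℕ; zero; suc; _+_; _<_; _≤_; _≟_)
open import Data.Fin using (Fin; zero; suc; toℕ; _<?_)
open import Data.Fin.Subset using (Subset; _∈_; _∉_; ∣_∣)
open import Data.Bool using (Bool; true; false; if_then_else_; _∨_)
open import Data.Empty using (⊥)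
open import Data.List using (List; map; allFin)
open import Data.Nat.ListAction using (sum)
open import Data.Product using (Σ; ∃; _×_; _,_)
open import Data.Sum using (_⊎_)
open import Relation.Nullary using (¬_; yes; no)
open import Relation.Binary.PropositionalEquality using (_≡_; _≢_)
open import Function.Definitions using (Injective)

record Graph (n : ℕ) : Set where
  field
    adj    : Fin n → Fin n → Bool
    sym    : ∀ u v → adj u v ≡ adj v u
    irrefl : ∀ v → adj v v ≡ false
open Graph public

Adj : ∀ {n} → Graph n → Fin n → Fin n → Set
Adj G u v = adj G u v ≡ true

edgeCount : ∀ {n} → Graph n → ℕ
edgeCount {n} G =
  sum (map (λ u → sum (map (λ v → edgeAt u v) (allFin n))) (allFin n))
  where
  edgeAt : Fin n → Fin n → ℕ
  edgeAt u v with u <? v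
  ... | yes _ = if adj G u v then 1 else 0
  ... | no _  = 0

data PathAvoiding {n} (G : Graph n) (S : Subset n) : Fin n → Fin n → Set where
  here : ∀ {u} → u ∉ S → PathAvoiding G S u u
  step : ∀ {u w v} → u ∉ S → Adj G u w → PathAvoiding G S w v → PathAvoiding G S u v

ConnectedAfterRemoving : ∀ {n} → Graph n → Subset n → Set
ConnectedAfterRemoving {n} G S = ∀ (u v : Fin n) → u ∉ S → v ∉ S → PathAvoiding G S u v

KConnected : ℕ → ∀ {n} → Graph n → Set
KConnected k {n} G = k < n × (∀ (S : Subset n) → ∣ S ∣ < k → ConnectedAfterRemoving G S)

record SubgraphOf {m n} (H : Graph m) (G : Graph n) : Set where
  field
    f        : Fin m → Fin n
    f-inj    : Injective _≡_ _≡_ f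
    edges-⊆  : ∀ i j → Adj H i j → Adj G (f i) (f j)
open SubgraphOf public

Proper : ∀ {m n} {H : Graph m} {G : Graph n} → SubgraphOf H G → Set
Proper {m} {n} {H} {G} s =
  (Σ (Fin n) λ v → ∀ i → f s i ≢ v)
  ⊎ (Σ (Fin n) λ u → Σ (Fin n) λ v → Adj G u v ×
       ¬ (Σ (Fin m) λ i → Σ (Fin m) λ j → f s i ≡ u × f s j ≡ v × Adj H i j))

SuperMinimallyKConnected : ℕ → ∀ {n} → Graph n → Set
SuperMinimallyKConnected k {n} G =
  KConnected k G ×
  (∀ (m : ℕ) (H : Graph m) (s : SubgraphOf H G) → Proper s → ¬ KConnected k H)

-- the wheel with m spokes, vertex set Fin (suc m): hub = zero, rim vertex i = suc i,
-- rim vertices i and j adjacent iff j ≡ i + 1 (mod m) or i ≡ j + 1 (mod m)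
rimNext : ∀ {m} → Fin m → Fin m → Bool
rimNext {m} i j with toℕ j ≟ suc (toℕ i)
... | yes _ = true
... | no _ with toℕ j | suc (toℕ i) ≟ m
...   | zero | yes _ = true
...   | _    | _     = false

wheelAdj : ∀ {m} → Fin (suc m) → Fin (suc m) → Bool
wheelAdj zero zero = false
wheelAdj zero (suc _) = true
wheelAdj (suc _) zero = true
wheelAdj (suc i) (suc j) = rimNext i j ∨ rimNext j i

record IsoTo {n} (G : Graph n) (a : Fin n → Fin n → Bool) : Set where
  field
    to     : Fin n → Fin n
    from   : Fin n → Fin n
    to-from : ∀ x → to (from x) ≡ x
    from-to : ∀ x → from (to x) ≡ x
    preserves : ∀ u v → adj G u v ≡ a (to u) (to v)

IsWheel≥3 : ∀ {n} → Graph n → Set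
IsWheel≥3 {zero} G = ⊥
IsWheel≥3 {suc m} G = 3 ≤ m × IsoTo G wheelAdj

{-# OPTIONS --safe #-}
-- A 3-connected graph G contains a subdivision of a 3-connected multigraph K with vertices B, edges T,
-- |T| ≤ 2 |B| − 2: at first K₄, found from a cycle with a chord and an ear crossing the chord.
-- As long as an edge ab of K is properly subdivided, G − {a , b} is connected and so yields an ear
-- from the inside of ab to the rest. If the ear ends in a branch vertex, K gains one vertex
-- and two edges; if it ends inside another edge, K gains two vertices and three edges, unless that
-- edge is parallel to ab and can be dropped. So 2 |B| − |T| never decreases, and at the end K is a
-- 3-connected subgraph of G, which is G itself by minimality.
--
-- For equality, K is kept a wheel. An ear to the hub enlarges the wheel, and for three spokes every
-- vertex can be taken as the hub. For an ear to a rim vertex y of a larger wheel, the spoke at y is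
-- deleted first; then y is an inner vertex of an edge, and 2 |B| − |T| grows strictly.
module Submission where

open import Defs hiding (sym)
open import Data.Nat using (ℕ; zero; suc; _+_; _*_; _∸_; _≤_; _<_; z≤n; s≤s)
import Data.Nat.Properties as ℕₚ
open import Data.Fin as Fin using (fromℕ<; Fin; zero; suc; toℕ; _<?_; cast)
open import Data.Fin.Properties using (_≟_; toℕ-injective; toℕ<n; injective⇒≤)
import Data.Fin.Properties as Finₚ
open import Data.Fin.Subset using (Subset; ∣_∣; ⁅_⁆; _∪_)
open import Data.Vec as Vec using ([]; _∷_)
import Data.Fin.Subset as Sub
import Data.Fin.Subset.Properties as Subₚ
open import Data.Bool using (Bool; true; false; if_then_else_; _∨_)
import Data.Bool.Properties as Boolₚ
open import Data.Empty using (⊥; ⊥-elim)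
open import Data.Unit using (⊤; tt)
open import Data.List using (List; []; _∷_; [_]; _++_; map; length; lookup; concatMap; reverse; filter; allFin; cartesianProduct; initLast; _∷ʳ′_)
import Data.List.Properties as Listₚ
open import Data.List.Membership.Propositional using (_∈_; _∉_; find)
open import Data.List.Membership.Propositional.Properties using (∈-++⁺ˡ; ∈-++⁺ʳ; ∈-++⁻; ∈-∃++; ∈-lookup; ∈-filter⁺; ∈-filter⁻; ∈-concatMap⁻; ∈-cartesianProduct⁺; ∈-allFin; ∈-map⁺; ∈-map⁻)
import Data.List.Membership.DecPropositional as DecMem
open import Data.List.Relation.Unary.All as All using (All; []; _∷_)
import Data.List.Relation.Unary.All.Properties as Allₚ
open import Data.List.Relation.Unary.Any as Any using (Any; here; there; any?)
import Data.List.Relation.Unary.Any.Properties as Anyₚ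
open import Data.List.Relation.Unary.AllPairs as AllPairs using ([]; _∷_)
open import Data.List.Relation.Unary.Unique.Propositional using (Unique)
import Data.List.Relation.Unary.Unique.Propositional.Properties as Uniqueₚ
open import Data.List.Relation.Binary.Permutation.Propositional using (_↭_; ↭-refl; ↭-sym; ↭-trans; ↭-reflexive; prep; swap; ↭⇒↭ₛ)
import Data.List.Relation.Binary.Permutation.Propositional.Properties as Permₚ
import Data.List.Relation.Binary.Permutation.Setoid.Properties as SetoidPermₚ
open import Data.Nat.ListAction using (sum)
open import Data.Product using (∃; _×_; _,_; proj₁; proj₂)
open import Data.Sum as Sum using (_⊎_; inj₁; inj₂; [_,_]′)
open import Function using (_∘_; id; case_of_; mk⇔)
open import Relation.Nullary using (¬_; Dec; yes; no)
open import Relation.Nullary.Decidable using (_×-dec_; _⊎-dec_; ¬?; decidable-stable; does; dec-true; dec-false)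
open import Relation.Binary using (Symmetric; _⇒_; tri<; tri≈; tri>)
open import Relation.Binary.Construct.Closure.ReflexiveTransitive as Star using (Star; ε; _◅_; _◅◅_)
open import Relation.Binary.PropositionalEquality using (_≡_; _≢_; refl; sym; trans; cong; cong₂; subst; subst₂; ≢-sym; setoid; module ≡-Reasoning)

-- Lists without repetitions

-- The 2 in the bound is the value of 2 |B| - |T| for every wheel: `k` spokes give `k + 1` vertices
-- and `2 k` edges. Equality can only survive through steps that keep this value, that is, ears
-- ending in a branch vertex; but such an ear need not turn a wheel into a wheel. The wheel shape is
-- therefore maintained only while the value is 2. Once it is 3, any frame will do, because no later
-- step lowers it and the final inequality is strict.
--
-- Deleting the spoke at y removes one vertex and two edges, so the smaller wheel still has the
-- value 2, and the ear, which now joins inner vertices of two edges, raises it to 3. The smaller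
-- wheel must itself have three spokes; hence the separate treatment of a subdivided K₄, where the
-- hub is changed instead.
--
-- Branch vertices and inner vertices are kept in one list without repetitions. Disjointness after
-- each surgery then amounts to a permutation of concatenated lists.

unique-↭ : {A : Set} {xs ys : List A} → xs ↭ ys → Unique xs → Unique ys
unique-↭ {A} p = SetoidPermₚ.Unique-resp-↭ (setoid A) (↭⇒↭ₛ p)

unique-++⁻ʳ : {A : Set} (xs : List A) {ys : List A} → Unique (xs ++ ys) → Unique ys
unique-++⁻ʳ []       uq       = uq
unique-++⁻ʳ (x ∷ xs) (_ ∷ uq) = unique-++⁻ʳ xs uq

unique-++⁻ˡ : {A : Set} (xs : List A) {ys : List A} → Unique (xs ++ ys) → Unique xs
unique-++⁻ˡ []       uq       = []
unique-++⁻ˡ (x ∷ xs) (x∉ ∷ uq) = Allₚ.++⁻ˡ xs x∉ ∷ unique-++⁻ˡ xs uq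

unique-++-disjoint : {A : Set} (xs : List A) {ys : List A} → Unique (xs ++ ys) →
  ∀ {v} → v ∈ xs → v ∉ ys
unique-++-disjoint (x ∷ xs) (x∉ ∷ uq) (here refl) v∈ys = All.lookup (Allₚ.++⁻ʳ xs x∉) v∈ys refl
unique-++-disjoint (x ∷ xs) (x∉ ∷ uq) (there v∈)  v∈ys = unique-++-disjoint xs uq v∈ v∈ys

lookup-injective : {A : Set} {xs : List A} → Unique xs →
  ∀ i j → lookup xs i ≡ lookup xs j → i ≡ j
lookup-injective (x∉ ∷ uq) zero    zero    eq = refl
lookup-injective (x∉ ∷ uq) zero    (suc j) eq = ⊥-elim (All.lookup x∉ (∈-lookup j) eq)
lookup-injective (x∉ ∷ uq) (suc i) zero    eq = ⊥-elim (All.lookup x∉ (∈-lookup i) (sym eq))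
lookup-injective (x∉ ∷ uq) (suc i) (suc j) eq = cong suc (lookup-injective uq i j eq)

unique-⊆-length : {A : Set} {xs ys : List A} → Unique xs →
  (∀ {v} → v ∈ xs → v ∈ ys) → length xs ≤ length ys
unique-⊆-length {xs = xs} {ys} uq xs⊆ys = injective⇒≤ {f = pos} inj
  where
  pos : Fin (length xs) → Fin (length ys)
  pos i = Any.index (xs⊆ys (∈-lookup i))
  inj : ∀ {i j} → pos i ≡ pos j → i ≡ j
  inj {i} {j} eq = lookup-injective uq i j
    (trans (Anyₚ.lookup-index (xs⊆ys (∈-lookup i)))
      (trans (cong (lookup ys) eq) (sym (Anyₚ.lookup-index (xs⊆ys (∈-lookup j))))))

-- Otherwise `B` would lie in a list of length three. The vertices `a`, `b`, `c` may coincide, and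
-- callers with fewer vertices to avoid repeat one.
pick-fourth : ∀ {n} {B : List (Fin n)} → Unique B → 4 ≤ length B → ∀ a b c →
  ∃ λ w → w ∈ B × w ≢ a × w ≢ b × w ≢ c
pick-fourth {B = B} uq 4≤ a b c
  with any? (λ w → ¬? (w ≟ a) ×-dec ¬? (w ≟ b) ×-dec ¬? (w ≟ c)) B
... | yes found = find found
... | no none = ⊥-elim (ℕₚ.<⇒≱ 4≤ (unique-⊆-length uq covered))
  where
  covered : ∀ {v} → v ∈ B → v ∈ a ∷ b ∷ c ∷ []
  covered {v} v∈ with v ≟ a | v ≟ b | v ≟ c
  ... | yes v≡a | _ | _ = here v≡a
  ... | no _ | yes v≡b | _ = there (here v≡b)
  ... | no _ | no _ | yes v≡c = there (there (here v≡c))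
  ... | no v≢a | no v≢b | no v≢c = ⊥-elim (none (Any.map (λ { refl → v≢a , v≢b , v≢c }) v∈))

-- 3-connectivity of multigraphs

Off : ∀ {n} → Fin n → Fin n → Fin n → Set
Off s t u = u ≢ s × u ≢ t

Avoiding : ∀ {n} → (Fin n → Fin n → Set) → Fin n → Fin n → Fin n → Fin n → Set
Avoiding E s t u w = E u w × Off s t u × Off s t w

-- Since `s` and `t` may coincide, the deletion of a single vertex is included. Only the adjacency
-- relation matters, so parallel edges are invisible here.
Conn3 : ∀ {n} → List (Fin n) → (Fin n → Fin n → Set) → Set
Conn3 B E = ∀ s t {u v} → u ∈ B → v ∈ B → Off s t u → Off s t v → Star (Avoiding E s t) u v

Ends : ∀ {n} → Fin n → Fin n → Fin n → Fin n → Set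
Ends a b u w = (u ≡ a × w ≡ b) ⊎ (u ≡ b × w ≡ a)

off? : ∀ {n} (s t u : Fin n) → Dec (Off s t u)
off? s t u = ¬? (u ≟ s) ×-dec ¬? (u ≟ t)

¬off : ∀ {n} {s t u : Fin n} → ¬ Off s t u → u ≡ s ⊎ u ≡ t
¬off {s = s} {t} {u} ¬o with u ≟ s | u ≟ t
... | yes p | _     = inj₁ p
... | no _  | yes q = inj₂ q
... | no p  | no q  = ⊥-elim (¬o (p , q))

off-swap : ∀ {n} {s t u : Fin n} → Off s t u → Off t s u
off-swap (p , q) = q , p

module _ {n : ℕ} {E : Fin n → Fin n → Set} where

  avoiding-sym : Symmetric E → ∀ {s t} → Symmetric (Avoiding E s t)
  avoiding-sym E-sym (e , o , o′) = E-sym e , o′ , o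

  avoiding-swap : ∀ {s t u v} → Star (Avoiding E s t) u v → Star (Avoiding E t s) u v
  avoiding-swap = Star.map λ (e , o , o′) → e , off-swap o , off-swap o′

  avoiding-reverse : Symmetric E → ∀ {s t u v} → Star (Avoiding E s t) u v → Star (Avoiding E s t) v u
  avoiding-reverse E-sym = Star.reverse (avoiding-sym E-sym)

  conn3-extend : ∀ {B B′} → Symmetric E → Conn3 B E →
    (∀ s t {u} → u ∈ B′ → Off s t u →
      ∃ λ u′ → u′ ∈ B × Off s t u′ × Star (Avoiding E s t) u u′) →
    Conn3 B′ E
  conn3-extend E-sym conn reach s t u∈ v∈ ou ov
    with reach s t u∈ ou | reach s t v∈ ov
  ... | u′ , u′∈ , ou′ , pu | v′ , v′∈ , ov′ , pv =
    pu ◅◅ conn s t u′∈ v′∈ ou′ ov′ ◅◅ avoiding-reverse E-sym pv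

  -- Two deleted vertices cannot exhaust three distinct neighbours, so `x` always keeps a way into
  -- `B`.
  conn3-add-vertex : ∀ {B x a b c} → Symmetric E → Conn3 B E →
    a ∈ B → b ∈ B → c ∈ B → a ≢ b → c ≢ a → c ≢ b →
    E x a → E x b → E x c → Conn3 (x ∷ B) E
  conn3-add-vertex {B} {x} {a} {b} {c} E-sym conn a∈ b∈ c∈ a≢b c≢a c≢b xa xb xc =
    conn3-extend E-sym conn reach
    where
    reach : ∀ s t {u} → u ∈ x ∷ B → Off s t u →
      ∃ λ u′ → u′ ∈ B × Off s t u′ × Star (Avoiding E s t) u u′
    reach s t (there u∈)  ou = _ , u∈ , ou , ε
    reach s t (here refl) ou with off? s t a | off? s t b | off? s t c
    ... | yes oa | _ | _ = a , a∈ , oa , (xa , ou , oa) ◅ ε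
    ... | no _ | yes ob | _ = b , b∈ , ob , (xb , ou , ob) ◅ ε
    ... | no _ | no _ | yes oc = c , c∈ , oc , (xc , ou , oc) ◅ ε
    ... | no ¬a | no ¬b | no ¬c with ¬off ¬a | ¬off ¬b | ¬off ¬c
    ...   | inj₁ p | inj₁ q | _      = ⊥-elim (a≢b (trans p (sym q)))
    ...   | inj₂ p | inj₂ q | _      = ⊥-elim (a≢b (trans p (sym q)))
    ...   | inj₁ p | inj₂ q | inj₁ r = ⊥-elim (c≢a (trans r (sym p)))
    ...   | inj₁ p | inj₂ q | inj₂ r = ⊥-elim (c≢b (trans r (sym q)))
    ...   | inj₂ p | inj₁ q | inj₁ r = ⊥-elim (c≢b (trans r (sym q)))
    ...   | inj₂ p | inj₁ q | inj₂ r = ⊥-elim (c≢a (trans r (sym p)))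

avoid-end : ∀ {n} {E E′ : Fin n → Fin n → Set} {a b} →
  (∀ {u w} → E u w → E′ u w ⊎ Ends a b u w) →
  ∀ {t} → Avoiding E a t ⇒ Avoiding E′ t t
avoid-end split (e , (u≢a , u≢t) , (w≢a , w≢t)) with split e
... | inj₁ e′ = e′ , (u≢t , u≢t) , (w≢t , w≢t)
... | inj₂ (inj₁ (u≡a , _)) = ⊥-elim (u≢a u≡a)
... | inj₂ (inj₂ (_ , w≡a)) = ⊥-elim (w≢a w≡a)

ends-swap : ∀ {n} {a b u w : Fin n} → Ends a b u w → Ends b a u w
ends-swap (inj₁ p) = inj₂ p
ends-swap (inj₂ p) = inj₁ p

ends-sym : ∀ {n} {a b : Fin n} → Symmetric (Ends a b)
ends-sym (inj₁ (p , q)) = inj₂ (q , p)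
ends-sym (inj₂ (p , q)) = inj₁ (q , p)

-- Losing an edge costs at most one degree of connectivity. Every vertex is led to a common `w` off
-- `a`, `b`, `t` by a walk that avoids `t` and an end of the edge different from the start; such a
-- walk cannot use the edge.
conn3-delete-edge : ∀ {n} {B : List (Fin n)} {E E′ : Fin n → Fin n → Set} {a b} →
  Unique B → 4 ≤ length B → Conn3 B E → Symmetric E′ → a ≢ b →
  (∀ {u w} → E u w → E′ u w ⊎ Ends a b u w) →
  ∀ t {u v} → u ∈ B → v ∈ B → u ≢ t → v ≢ t → Star (Avoiding E′ t t) u v
conn3-delete-edge {B = B} {E} {E′} {a} {b} uq 4≤ conn E′-sym a≢b split t u∈ v∈ u≢t v≢t =
  to-w u∈ u≢t ◅◅ avoiding-reverse E′-sym (to-w v∈ v≢t)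
  where
  fourth = pick-fourth uq 4≤ a b t
  w = proj₁ fourth
  w∈ = proj₁ (proj₂ fourth)
  w≢a = proj₁ (proj₂ (proj₂ fourth))
  w≢b = proj₁ (proj₂ (proj₂ (proj₂ fourth)))
  w≢t = proj₂ (proj₂ (proj₂ (proj₂ fourth)))
  to-w : ∀ {u} → u ∈ B → u ≢ t → Star (Avoiding E′ t t) u w
  to-w {u} u∈ u≢t with u ≟ a
  ... | no u≢a   = Star.map (avoid-end split) (conn a t u∈ w∈ (u≢a , u≢t) (w≢a , w≢t))
  ... | yes refl = Star.map (avoid-end (Sum.map₂ ends-swap ∘ split))
                     (conn b t u∈ w∈ (a≢b , u≢t) (w≢b , w≢t))

-- If `x` is deleted, the edge ab is lost with it, but at most one further vertex is gone, and
-- `conn3-delete-edge` applies. Otherwise each use of ab is rerouted through `x`.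
conn3-subdivide : ∀ {n} {B : List (Fin n)} {E E′ E″ : Fin n → Fin n → Set} {a b c x} →
  Unique B → 4 ≤ length B → Conn3 B E → Symmetric E′ → Symmetric E″ →
  a ∈ B → b ∈ B → c ∈ B → a ≢ b → c ≢ a → c ≢ b → x ∉ B →
  (∀ {u w} → E u w → E′ u w ⊎ Ends a b u w) →
  (∀ {u w} → E′ u w → u ∈ B × w ∈ B) → E′ ⇒ E″ →
  E″ x a → E″ x b → E″ x c → Conn3 (x ∷ B) E″
conn3-subdivide {B = B} {E} {E′} {E″} {a} {b} {c} {x}
  uq 4≤ conn E′-sym E″-sym a∈ b∈ c∈ a≢b c≢a c≢b x∉ split inB E′⊆E″ xa xb xc =
  conn3-add-vertex E″-sym old a∈ b∈ c∈ a≢b c≢a c≢b xa xb xc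
  where
  old-x : ∀ t {u v} → u ∈ B → v ∈ B → u ≢ t → v ≢ t → Star (Avoiding E″ x t) u v
  old-x t u∈ v∈ u≢t v≢t = Star.map
    (λ (e , (p , _) , (q , _)) → E′⊆E″ e ,
      ((λ { refl → x∉ (proj₁ (inB e)) }) , p) , ((λ { refl → x∉ (proj₂ (inB e)) }) , q))
    (conn3-delete-edge uq 4≤ conn E′-sym a≢b split t u∈ v∈ u≢t v≢t)
  old : Conn3 B E″
  old s t u∈ v∈ ou ov with x ≟ s | x ≟ t
  ... | yes refl | _        = old-x t u∈ v∈ (proj₂ ou) (proj₂ ov)
  ... | no _     | yes refl = avoiding-swap (old-x s u∈ v∈ (proj₁ ou) (proj₁ ov))
  ... | no x≢s   | no x≢t   = Star.concat (Star.map replace (conn s t u∈ v∈ ou ov))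
    where
    replace : Avoiding E s t ⇒ Star (Avoiding E″ s t)
    replace (e , p , q) with split e
    ... | inj₁ e′ = (E′⊆E″ e′ , p , q) ◅ ε
    ... | inj₂ (inj₁ (refl , refl)) = (E″-sym xa , p , x≢s , x≢t) ◅ (xb , (x≢s , x≢t) , q) ◅ ε
    ... | inj₂ (inj₂ (refl , refl)) = (E″-sym xb , p , x≢s , x≢t) ◅ (xa , (x≢s , x≢t) , q) ◅ ε

-- The edges ab and cd are subdivided by `x` and `y`, which are then joined. They may share an end,
-- but `c` must lie off `a` and `b`: when these two are deleted, `x` escapes through `y` to `c`.
conn3-join : ∀ {n} {B : List (Fin n)} {E E′ E″ : Fin n → Fin n → Set} {a b c d x y} →
  Unique B → 4 ≤ length B → Conn3 B E → Symmetric E′ → Symmetric E″ →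
  a ∈ B → b ∈ B → c ∈ B → d ∈ B → a ≢ b → c ≢ d → c ≢ a → c ≢ b →
  x ∉ B → y ∉ B → x ≢ y →
  (∀ {u w} → E u w → E′ u w ⊎ Ends a b u w ⊎ Ends c d u w) →
  (∀ {u w} → E′ u w → u ∈ B × w ∈ B) → E′ ⇒ E″ →
  E″ x a → E″ x b → E″ y c → E″ y d → E″ x y → Conn3 (y ∷ x ∷ B) E″
conn3-join {n} {B} {E} {E′} {E″} {a} {b} {c} {d} {x} {y}
  uq 4≤ conn E′-sym E″-sym a∈ b∈ c∈ d∈ a≢b c≢d c≢a c≢b x∉ y∉ x≢y split inB E′⊆E″ xa xb yc yd xy =
  conn3-add-vertex E″-sym (conn3-extend E″-sym old reach)
    (there c∈) (there d∈) (here refl) c≢d (x≢ c∈) (x≢ d∈) yc yd (E″-sym xy)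
  where
  x≢ : ∀ {p} → p ∈ B → x ≢ p
  x≢ p∈ refl = x∉ p∈
  y≢ : ∀ {p} → p ∈ B → y ≢ p
  y≢ p∈ refl = y∉ p∈

  -- Without `x` and `y` both edges are lost. A walk that avoids one end of each uses neither, so
  -- avoiding `a` and `c` suffices for all other vertices; `a` itself is first led away by avoiding
  -- `b` and `c`, and `c` by avoiding `a` and `d`.
  old-xy : ∀ {u v} → u ∈ B → v ∈ B → Star (Avoiding E″ x y) u v
  old-xy u∈ v∈ = let (u′ , u′∈ , ou , pu) = leave u∈
                     (v′ , v′∈ , ov , pv) = leave v∈
                 in pu ◅◅ Star.map plain (conn a c u′∈ v′∈ ou ov) ◅◅ avoiding-reverse E″-sym pv
    where
    lift : E′ ⇒ Avoiding E″ x y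
    lift e = let (p , q) = inB e in
      E′⊆E″ e , (≢-sym (x≢ p) , ≢-sym (y≢ p)) , (≢-sym (x≢ q) , ≢-sym (y≢ q))
    plain : Avoiding E a c ⇒ Avoiding E″ x y
    plain (e , (p , p′) , (q , q′)) with split e
    ... | inj₁ e′ = lift e′
    ... | inj₂ (inj₁ (inj₁ (u≡a , _))) = ⊥-elim (p u≡a)
    ... | inj₂ (inj₁ (inj₂ (_ , w≡a))) = ⊥-elim (q w≡a)
    ... | inj₂ (inj₂ (inj₁ (u≡c , _))) = ⊥-elim (p′ u≡c)
    ... | inj₂ (inj₂ (inj₂ (_ , w≡c))) = ⊥-elim (q′ w≡c)
    from-a : Avoiding E b c ⇒ Avoiding E″ x y
    from-a (e , (p , p′) , (q , q′)) with split e
    ... | inj₁ e′ = lift e′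
    ... | inj₂ (inj₁ (inj₁ (_ , w≡b))) = ⊥-elim (q w≡b)
    ... | inj₂ (inj₁ (inj₂ (u≡b , _))) = ⊥-elim (p u≡b)
    ... | inj₂ (inj₂ (inj₁ (u≡c , _))) = ⊥-elim (p′ u≡c)
    ... | inj₂ (inj₂ (inj₂ (_ , w≡c))) = ⊥-elim (q′ w≡c)
    from-c : Avoiding E a d ⇒ Avoiding E″ x y
    from-c (e , (p , p′) , (q , q′)) with split e
    ... | inj₁ e′ = lift e′
    ... | inj₂ (inj₁ (inj₁ (u≡a , _))) = ⊥-elim (p u≡a)
    ... | inj₂ (inj₁ (inj₂ (_ , w≡a))) = ⊥-elim (q w≡a)
    ... | inj₂ (inj₂ (inj₁ (_ , w≡d))) = ⊥-elim (q′ w≡d)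
    ... | inj₂ (inj₂ (inj₂ (u≡d , _))) = ⊥-elim (p′ u≡d)
    leave : ∀ {u} → u ∈ B → ∃ λ u′ → u′ ∈ B × Off a c u′ × Star (Avoiding E″ x y) u u′
    leave {u} u∈ with u ≟ a | u ≟ c
    ... | no u≢a | no u≢c = u , u∈ , (u≢a , u≢c) , ε
    ... | yes refl | _ =
      let (w , w∈ , w≢a , w≢c , w≢b) = pick-fourth uq 4≤ a c b
      in w , w∈ , (w≢a , w≢c) ,
         Star.map from-a (conn b c u∈ w∈ (a≢b , ≢-sym c≢a) (w≢b , w≢c))
    ... | no _ | yes refl =
      let (w , w∈ , w≢a , w≢c , w≢d) = pick-fourth uq 4≤ a c d
      in w , w∈ , (w≢a , w≢c) ,
         Star.map from-c (conn a d u∈ w∈ (c≢a , c≢d) (w≢a , w≢d))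

  E₁ E₂ : Fin n → Fin n → Set
  E₁ u w = E′ u w ⊎ Ends c d u w
  E₂ u w = E′ u w ⊎ Ends a b u w

  split₁ : ∀ {u w} → E u w → E₁ u w ⊎ Ends a b u w
  split₁ e with split e
  ... | inj₁ e′        = inj₁ (inj₁ e′)
  ... | inj₂ (inj₁ ab) = inj₂ ab
  ... | inj₂ (inj₂ cd) = inj₁ (inj₂ cd)

  split₂ : ∀ {u w} → E u w → E₂ u w ⊎ Ends c d u w
  split₂ e with split e
  ... | inj₁ e′        = inj₁ (inj₁ e′)
  ... | inj₂ (inj₁ ab) = inj₁ (inj₂ ab)
  ... | inj₂ (inj₂ cd) = inj₂ cd

  through-x : ∀ {s t u w} → Off s t x → Ends a b u w → Off s t u → Off s t w →
    Star (Avoiding E″ s t) u w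
  through-x ox (inj₁ (refl , refl)) p q = (E″-sym xa , p , ox) ◅ (xb , ox , q) ◅ ε
  through-x ox (inj₂ (refl , refl)) p q = (E″-sym xb , p , ox) ◅ (xa , ox , q) ◅ ε

  through-y : ∀ {s t u w} → Off s t y → Ends c d u w → Off s t u → Off s t w →
    Star (Avoiding E″ s t) u w
  through-y oy (inj₁ (refl , refl)) p q = (E″-sym yc , p , oy) ◅ (yd , oy , q) ◅ ε
  through-y oy (inj₂ (refl , refl)) p q = (E″-sym yd , p , oy) ◅ (yc , oy , q) ◅ ε

  ends-in : ∀ {p q u w} → p ∈ B → q ∈ B → Ends p q u w → u ∈ B × w ∈ B
  ends-in p∈ q∈ (inj₁ (refl , refl)) = p∈ , q∈
  ends-in p∈ q∈ (inj₂ (refl , refl)) = q∈ , p∈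

  old-x : ∀ t → y ≢ t → ∀ {u v} → u ∈ B → v ∈ B → u ≢ t → v ≢ t → Star (Avoiding E″ x t) u v
  old-x t y≢t u∈ v∈ u≢t v≢t = Star.concat (Star.map replace
    (conn3-delete-edge uq 4≤ conn (Sum.map E′-sym ends-sym) a≢b split₁ t u∈ v∈ u≢t v≢t))
    where
    replace : Avoiding E₁ t t ⇒ Star (Avoiding E″ x t)
    replace (inj₁ e , (p , _) , (q , _)) = let (u∈ , w∈) = inB e in
      (E′⊆E″ e , (≢-sym (x≢ u∈) , p) , (≢-sym (x≢ w∈) , q)) ◅ ε
    replace (inj₂ cd , (p , _) , (q , _)) = let (u∈ , w∈) = ends-in c∈ d∈ cd in
      through-y (≢-sym x≢y , y≢t) cd (≢-sym (x≢ u∈) , p) (≢-sym (x≢ w∈) , q)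

  old-y : ∀ t → x ≢ t → ∀ {u v} → u ∈ B → v ∈ B → u ≢ t → v ≢ t → Star (Avoiding E″ y t) u v
  old-y t x≢t u∈ v∈ u≢t v≢t = Star.concat (Star.map replace
    (conn3-delete-edge uq 4≤ conn (Sum.map E′-sym ends-sym) c≢d split₂ t u∈ v∈ u≢t v≢t))
    where
    replace : Avoiding E₂ t t ⇒ Star (Avoiding E″ y t)
    replace (inj₁ e , (p , _) , (q , _)) = let (u∈ , w∈) = inB e in
      (E′⊆E″ e , (≢-sym (y≢ u∈) , p) , (≢-sym (y≢ w∈) , q)) ◅ ε
    replace (inj₂ ab , (p , _) , (q , _)) = let (u∈ , w∈) = ends-in a∈ b∈ ab in
      through-x (x≢y , x≢t) ab (≢-sym (y≢ u∈) , p) (≢-sym (y≢ w∈) , q)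

  old : Conn3 B E″
  old s t u∈ v∈ (us , ut) (vs , vt) with x ≟ s | x ≟ t | y ≟ s | y ≟ t
  ... | yes refl | _ | _ | yes refl = old-xy u∈ v∈
  ... | yes refl | _ | _ | no y≢t = old-x t y≢t u∈ v∈ ut vt
  ... | no _ | yes refl | yes refl | _ = avoiding-swap (old-xy u∈ v∈)
  ... | no _ | yes refl | no y≢s | _ = avoiding-swap (old-x s y≢s u∈ v∈ us vs)
  ... | no _ | no x≢t | yes refl | _ = old-y t x≢t u∈ v∈ ut vt
  ... | no x≢s | no _ | no _ | yes refl = avoiding-swap (old-y s x≢s u∈ v∈ us vs)
  ... | no x≢s | no x≢t | no y≢s | no y≢t =
    Star.concat (Star.map replace (conn s t u∈ v∈ (us , ut) (vs , vt)))
    where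
    replace : Avoiding E s t ⇒ Star (Avoiding E″ s t)
    replace (e , p , q) with split e
    ... | inj₁ e′        = (E′⊆E″ e′ , p , q) ◅ ε
    ... | inj₂ (inj₁ ab) = through-x (x≢s , x≢t) ab p q
    ... | inj₂ (inj₂ cd) = through-y (y≢s , y≢t) cd p q

  reach : ∀ s t {u} → u ∈ x ∷ B → Off s t u →
    ∃ λ u′ → u′ ∈ B × Off s t u′ × Star (Avoiding E″ s t) u u′
  reach s t (there u∈)  ou = _ , u∈ , ou , ε
  reach s t (here refl) ou with off? s t a | off? s t b
  ... | yes oa | _ = a , a∈ , oa , (xa , ou , oa) ◅ ε
  ... | no _ | yes ob = b , b∈ , ob , (xb , ou , ob) ◅ ε
  ... | no ¬a | no ¬b with ¬off ¬a | ¬off ¬b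
  ...   | inj₁ p | inj₁ q = ⊥-elim (a≢b (trans p (sym q)))
  ...   | inj₂ p | inj₂ q = ⊥-elim (a≢b (trans p (sym q)))
  ...   | inj₁ refl | inj₂ refl = c , c∈ , (c≢a , c≢b) ,
    (xy , ou , y≢ a∈ , y≢ b∈) ◅ (yc , (y≢ a∈ , y≢ b∈) , c≢a , c≢b) ◅ ε
  ...   | inj₂ refl | inj₁ refl = c , c∈ , (c≢b , c≢a) ,
    (xy , ou , y≢ b∈ , y≢ a∈) ◅ (yc , (y≢ b∈ , y≢ a∈) , c≢b , c≢a) ◅ ε

-- Paths and ears

Link : ∀ {n} → Graph n → Fin n → List (Fin n) → Fin n → Set
Link G u []      v = Adj G u v
Link G u (q ∷ Q) v = Adj G u q × Link G q Q v

module _ {n : ℕ} (G : Graph n) where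

  open DecMem (_≟_ {n}) using (_∈?_)

  adj-sym : Symmetric (Adj G)
  adj-sym {u} {v} a = trans (Graph.sym G v u) a

  adj-irrefl : ∀ {u v} → Adj G u v → u ≢ v
  adj-irrefl {u} a refl with trans (sym a) (irrefl G u)
  ... | ()

  link-++⁻ : ∀ {u v x} X {Y} → Link G u (X ++ x ∷ Y) v → Link G u X x × Link G x Y v
  link-++⁻ []      (a , l) = a , l
  link-++⁻ (_ ∷ X) (a , l) = let (l₁ , l₂) = link-++⁻ X l in (a , l₁) , l₂

  link-++⁺ : ∀ {u v x} X {Y} → Link G u X x → Link G x Y v → Link G u (X ++ x ∷ Y) v
  link-++⁺ []      a       l = a , l
  link-++⁺ (_ ∷ X) (a , k) l = a , link-++⁺ X k l

  link-reverse : ∀ {u v} X → Link G u X v → Link G v (reverse X) u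
  link-reverse []      a = adj-sym a
  link-reverse {u} {v} (x ∷ X) (a , l) =
    subst (λ L → Link G v L u) (sym (Listₚ.unfold-reverse x X))
      (link-++⁺ (reverse X) (link-reverse X l) (adj-sym a))

  record Ear (S : Subset n) (X Y : List (Fin n)) : Set where
    constructor ear
    field
      {start end} : Fin n
      inner       : List (Fin n)
      start∈      : start ∈ X
      end∈        : end ∈ Y
      end∉        : end Sub.∉ S
      linked      : Link G start inner end
      distinct    : Unique inner
      avoidsX     : ∀ {q} → q ∈ inner → q ∉ X
      avoidsY     : ∀ {q} → q ∈ inner → q ∉ Y

  module _ {S : Subset n} {X Y : List (Fin n)} where

    record Tail (u : Fin n) : Set where
      constructor tail
      field
        {end}    : Fin n
        inner    : List (Fin n)
        end∈     : end ∈ Y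
        end∉     : end Sub.∉ S
        linked   : Link G u inner end
        distinct : Unique (u ∷ inner)
        avoidsX  : ∀ {q} → q ∈ inner → q ∉ X
        avoidsY  : ∀ {q} → q ∈ inner → q ∉ Y

    tail⇒ear : ∀ {u} → u ∈ X → Tail u → Ear S X Y
    tail⇒ear u∈ (tail Q y∈ y∉ l (_ ∷ uq) qx qy) = ear Q u∈ y∈ y∉ l uq qx qy

    -- Prepending `u` could repeat it. In that case the tail resumes after the other occurrence of
    -- `u`, and the loop in between disappears.
    tail-step : ∀ {u w} → Adj G u w → w ∉ X → w ∉ Y → Tail w → Tail u
    tail-step {u} {w} a w∉X w∉Y (tail Q y∈ y∉ l uq qx qy) with u ∈? (w ∷ Q)
    ... | no u∉ = tail (w ∷ Q) y∈ y∉ (a , l) (Allₚ.¬Any⇒All¬ _ u∉ ∷ uq)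
      (λ { (here refl) → w∉X ; (there q∈) → qx q∈ })
      (λ { (here refl) → w∉Y ; (there q∈) → qy q∈ })
    ... | yes u∈ = let (Q₁ , Q₂ , eq) = ∈-∃++ u∈ in loop Q₁ eq
      where
      loop : ∀ Q₁ {Q₂} → w ∷ Q ≡ Q₁ ++ u ∷ Q₂ → Tail u
      loop []        refl = tail Q y∈ y∉ l uq qx qy
      loop (_ ∷ Q₁) refl = tail _ y∈ y∉ (proj₂ (link-++⁻ Q₁ l)) (unique-++⁻ʳ (w ∷ Q₁) uq)
        (λ q∈ → qx (∈-++⁺ʳ Q₁ (there q∈))) (λ q∈ → qy (∈-++⁺ʳ Q₁ (there q∈)))

    path-start : ∀ {u v} → PathAvoiding G S u v → u Sub.∉ S
    path-start (here u∉)     = u∉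
    path-start (step u∉ _ _) = u∉

    -- The ear lies between the first vertex of `Y` on the walk and the last vertex of `X` before
    -- it: the recursion stops at the former, and on the way back the latter turns the tail into an
    -- ear.
    search : ∀ {u z} → PathAvoiding G S u z → z ∈ Y → u ∉ Y → Tail u ⊎ Ear S X Y
    search (here _) z∈ u∉ = ⊥-elim (u∉ z∈)
    search (step {w = w} _ a p) z∈ u∉ with w ∈? Y | w ∈? X
    ... | yes w∈Y | _ = inj₁ (tail [] w∈Y (path-start p) a ([] ∷ []) (λ ()) (λ ()))
    ... | no w∉Y | w∈?X with search p z∈ w∉Y
    ...   | inj₂ e = inj₂ e
    ...   | inj₁ t with w∈?X
    ...     | yes w∈X = inj₂ (tail⇒ear w∈X t)
    ...     | no w∉X  = inj₁ (tail-step a w∉X w∉Y t)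

    find-ear : ∀ {u z} → PathAvoiding G S u z → u ∈ X → z ∈ Y → u ∉ Y → Ear S X Y
    find-ear p u∈ z∈ u∉ with search p z∈ u∉
    ... | inj₁ t = tail⇒ear u∈ t
    ... | inj₂ e = e

∣∪∣≤ : ∀ {n} (p q : Subset n) → ∣ p ∪ q ∣ ≤ ∣ p ∣ + ∣ q ∣
∣∪∣≤ []          []          = z≤n
∣∪∣≤ (false ∷ p) (false ∷ q) = ∣∪∣≤ p q
∣∪∣≤ (false ∷ p) (true ∷ q)  = ℕₚ.≤-trans (s≤s (∣∪∣≤ p q)) (ℕₚ.≤-reflexive (sym (ℕₚ.+-suc _ _)))
∣∪∣≤ (true ∷ p)  (false ∷ q) = s≤s (∣∪∣≤ p q)
∣∪∣≤ (true ∷ p)  (true ∷ q)  = s≤s (ℕₚ.≤-trans (∣∪∣≤ p q) (ℕₚ.+-monoʳ-≤ _ (ℕₚ.n≤1+n _)))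

off⇒∉ : ∀ {n} {s t u : Fin n} → Off s t u → u Sub.∉ ⁅ s ⁆ ∪ ⁅ t ⁆
off⇒∉ {s = s} {t} (u≢s , u≢t) u∈ with Subₚ.x∈p∪q⁻ ⁅ s ⁆ ⁅ t ⁆ u∈
... | inj₁ p = u≢s (Subₚ.x∈⁅y⁆⇒x≡y s p)
... | inj₂ p = u≢t (Subₚ.x∈⁅y⁆⇒x≡y t p)

∉⇒off : ∀ {n} {s t u : Fin n} → u Sub.∉ ⁅ s ⁆ ∪ ⁅ t ⁆ → Off s t u
∉⇒off {s = s} {t} u∉ =
  (λ { refl → u∉ (Subₚ.x∈p∪q⁺ (inj₁ (Subₚ.x∈⁅x⁆ s))) }) ,
  (λ { refl → u∉ (Subₚ.x∈p∪q⁺ (inj₂ (Subₚ.x∈⁅x⁆ t))) })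

path-avoiding-pair : ∀ {n} {G : Graph n} → KConnected 3 G → ∀ s t {u v} →
  Off s t u → Off s t v → PathAvoiding G (⁅ s ⁆ ∪ ⁅ t ⁆) u v
path-avoiding-pair (_ , conn) s t ou ov = conn (⁅ s ⁆ ∪ ⁅ t ⁆) (s≤s small) _ _ (off⇒∉ ou) (off⇒∉ ov)
  where
  small : ∣ ⁅ s ⁆ ∪ ⁅ t ⁆ ∣ ≤ 2
  small = ℕₚ.≤-trans (∣∪∣≤ ⁅ s ⁆ ⁅ t ⁆)
    (ℕₚ.≤-reflexive (cong₂ _+_ (Subₚ.∣⁅x⁆∣≡1 s) (Subₚ.∣⁅x⁆∣≡1 t)))

-- Subdivisions

record Thread (n : ℕ) : Set where
  constructor thread
  field
    src   : Fin n
    inner : List (Fin n)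
    tgt   : Fin n
open Thread public

KAdj : ∀ {n} → List (Thread n) → Fin n → Fin n → Set
KAdj T u w = Any (λ t → Ends (src t) (tgt t) u w) T

inners : ∀ {n} → List (Thread n) → List (Fin n)
inners = concatMap inner

inners-↭ : ∀ {n} {T T′ : List (Thread n)} → T ↭ T′ → inners T ↭ inners T′
inners-↭ _↭_.refl         = ↭-refl
inners-↭ (prep t p)       = Permₚ.++⁺ˡ (inner t) (inners-↭ p)
inners-↭ (swap {xs} {ys} t u p) = ↭-trans (Permₚ.shifts (inner t) (inner u))
  (Permₚ.++⁺ˡ (inner u) (Permₚ.++⁺ˡ (inner t) (inners-↭ p)))
inners-↭ (_↭_.trans p q)  = ↭-trans (inners-↭ p) (inners-↭ q)

kadj-sym : ∀ {n} {T : List (Thread n)} → Symmetric (KAdj T)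
kadj-sym = Any.map ends-sym

∈-↭ : {A : Set} {x : A} {xs : List A} → x ∈ xs → ∃ λ ys → xs ↭ x ∷ ys
∈-↭ x∈ with ∈-∃++ x∈
... | ys , zs , refl = ys ++ zs , Permₚ.shift _ ys zs

GoodThread : ∀ {n} → Graph n → List (Fin n) → Thread n → Set
GoodThread G B t = src t ∈ B × tgt t ∈ B × src t ≢ tgt t × Link G (src t) (inner t) (tgt t)

-- A subdivision, inside G, of the 3-connected multigraph with vertex set B and edge set T; an
-- edge stands for the path through its inner vertices. There are at most 2 |B| − k edges.
record Frame {n} (G : Graph n) (B : List (Fin n)) (T : List (Thread n)) (k : ℕ) : Set where
  constructor frame
  field
    distinct : Unique (B ++ inners T)
    good     : All (GoodThread G B) T
    conn     : Conn3 B (KAdj T)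
    four     : 4 ≤ length B
    slack    : length T + k ≤ 2 * length B

module _ {n : ℕ} {G : Graph n} where

  open Frame

  frame-↭ : ∀ {B T T′ k} → T ↭ T′ → Frame G B T k → Frame G B T′ k
  frame-↭ {B} {T} {T′} {k} p F = frame
    (unique-↭ (Permₚ.++⁺ˡ B (inners-↭ p)) (distinct F))
    (Permₚ.All-resp-↭ p (good F))
    (λ s t u∈ v∈ ou ov → Star.map (λ (e , o) → Permₚ.Any-resp-↭ p e , o) (conn F s t u∈ v∈ ou ov))
    (four F)
    (subst (λ l → l + k ≤ _) (Permₚ.↭-length p) (slack F))

  frame-weaken : ∀ {B T k} → Frame G B T (suc k) → Frame G B T k
  frame-weaken F = frame (distinct F) (good F) (conn F) (four F)
    (ℕₚ.≤-trans (ℕₚ.+-monoʳ-≤ _ (ℕₚ.n≤1+n _)) (slack F))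

  kadj-in : ∀ {B T} → All (GoodThread G B) T → ∀ {u w} → KAdj T u w → u ∈ B × w ∈ B
  kadj-in ((s∈ , t∈ , _) ∷ _) (here (inj₁ (refl , refl))) = s∈ , t∈
  kadj-in ((s∈ , t∈ , _) ∷ _) (here (inj₂ (refl , refl))) = t∈ , s∈
  kadj-in (_ ∷ g)             (there e)                   = kadj-in g e

  good-⊆ : ∀ {B B′ T} → (∀ {v} → v ∈ B → v ∈ B′) → All (GoodThread G B) T → All (GoodThread G B′) T
  good-⊆ sub = All.map λ (s∈ , t∈ , r) → sub s∈ , sub t∈ , r

-- Surgery on frames

module _ {n : ℕ} where
  open import Algebra.Solver.CommutativeMonoid (Permₚ.++-commutativeMonoid {A = Fin n}) public
    using (solve; _⊜_; _⊕_) renaming (id to ∅)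

module _ {n : ℕ} {G : Graph n} where

  open Frame

  frame-subdivide : ∀ {B T k a b x y} X₁ X₂ Q →
    Frame G B (thread a (X₁ ++ x ∷ X₂) b ∷ T) k →
    y ∈ B → y ≢ a → y ≢ b → Link G x Q y → Unique Q →
    (∀ {q} → q ∈ Q → q ∉ B ++ inners (thread a (X₁ ++ x ∷ X₂) b ∷ T)) →
    Frame G (x ∷ B) (thread a X₁ x ∷ thread x X₂ b ∷ thread x Q y ∷ T) k
  frame-subdivide {B} {T} {k} {a} {b} {x} {y} X₁ X₂ Q F y∈ y≢a y≢b xQy uQ Q∉
    with good F
  ... | (a∈ , b∈ , a≢b , aXb) ∷ goodT = frame
    (unique-↭
      -- The fresh vertices `Q` are put in front of all old vertices; the rearrangement then moves
      -- `x` from the inside of the host edge to the branch vertices.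
      (solve 6 (λ q β x₁ ξ x₂ δ → q ⊕ β ⊕ (x₁ ⊕ ξ ⊕ x₂) ⊕ δ ⊜ ξ ⊕ β ⊕ x₁ ⊕ x₂ ⊕ q ⊕ δ)
        ↭-refl Q B X₁ [ x ] X₂ (inners T))
      (Uniqueₚ.++⁺ uQ (distinct F) (λ (q∈ , q∈′) → Q∉ q∈ q∈′)))
    ((there a∈ , here refl , (λ { refl → x∉ a∈ }) , proj₁ split)
      ∷ (here refl , there b∈ , (λ { refl → x∉ b∈ }) , proj₂ split)
      ∷ (here refl , there y∈ , (λ { refl → x∉ y∈ }) , xQy)
      ∷ good-⊆ there goodT)
    (conn3-subdivide (unique-++⁻ˡ B (distinct F)) (four F) (conn F) kadj-sym kadj-sym
      a∈ b∈ y∈ a≢b y≢a y≢b x∉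
      (λ { (here e) → inj₂ e ; (there e) → inj₁ e })
      (kadj-in goodT)
      (λ e → there (there (there e)))
      (here (inj₂ (refl , refl))) (there (here (inj₁ (refl , refl))))
      (there (there (here (inj₁ (refl , refl))))))
    (ℕₚ.≤-trans (four F) (ℕₚ.n≤1+n _))
    (ℕₚ.≤-trans (s≤s (s≤s (slack F))) (ℕₚ.≤-reflexive (sym (ℕₚ.*-suc 2 (length B)))))
    where
    split = link-++⁻ G X₁ aXb
    x∉ : x ∉ B
    x∉ x∈ = unique-++-disjoint B (distinct F) x∈ (∈-++⁺ˡ (∈-++⁺ʳ X₁ (here refl)))

  -- The condition says that the two edges are not parallel. Whichever end of the second lies off
  -- the first serves as the escape in `conn3-join`; if it is `d`, the second edge is read
  -- backwards.
  frame-join : ∀ {B T k a b c d x y} X₁ X₂ Y₁ Y₂ Q →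
    Frame G B (thread a (X₁ ++ x ∷ X₂) b ∷ thread c (Y₁ ++ y ∷ Y₂) d ∷ T) k →
    Off a b c ⊎ Off a b d → Link G x Q y → Unique Q →
    (∀ {q} → q ∈ Q →
      q ∉ B ++ inners (thread a (X₁ ++ x ∷ X₂) b ∷ thread c (Y₁ ++ y ∷ Y₂) d ∷ T)) →
    Frame G (y ∷ x ∷ B)
      (thread a X₁ x ∷ thread x X₂ b ∷ thread c Y₁ y ∷ thread y Y₂ d ∷ thread x Q y ∷ T) (suc k)
  frame-join {B} {T} {k} {a} {b} {c} {d} {x} {y} X₁ X₂ Y₁ Y₂ Q F off xQy uQ Q∉
    with good F
  ... | (a∈ , b∈ , a≢b , aXb) ∷ (c∈ , d∈ , c≢d , cYd) ∷ goodT = frame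
    (unique-↭
      (solve 9 (λ q β x₁ ξ x₂ y₁ η y₂ δ →
          q ⊕ β ⊕ (x₁ ⊕ ξ ⊕ x₂) ⊕ (y₁ ⊕ η ⊕ y₂) ⊕ δ ⊜ η ⊕ ξ ⊕ β ⊕ x₁ ⊕ x₂ ⊕ y₁ ⊕ y₂ ⊕ q ⊕ δ)
        ↭-refl Q B X₁ [ x ] X₂ Y₁ [ y ] Y₂ (inners T))
      (Uniqueₚ.++⁺ uQ (distinct F) (λ (q∈ , q∈′) → Q∉ q∈ q∈′)))
    ((there (there a∈) , there (here refl) , (λ { refl → x∉ a∈ }) , proj₁ splitX)
      ∷ (there (here refl) , there (there b∈) , (λ { refl → x∉ b∈ }) , proj₂ splitX)
      ∷ (there (there c∈) , here refl , (λ { refl → y∉ c∈ }) , proj₁ splitY)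
      ∷ (here refl , there (there d∈) , (λ { refl → y∉ d∈ }) , proj₂ splitY)
      ∷ (there (here refl) , here refl , x≢y , xQy)
      ∷ good-⊆ (λ p → there (there p)) goodT)
    (connected off)
    (ℕₚ.≤-trans (four F) (ℕₚ.≤-trans (ℕₚ.n≤1+n _) (ℕₚ.n≤1+n _)))
    (begin
      5 + length T + suc k        ≡⟨ ℕₚ.+-suc (5 + length T) k ⟩
      4 + (2 + length T + k)      ≤⟨ ℕₚ.+-monoʳ-≤ 4 (slack F) ⟩
      4 + 2 * length B            ≡⟨ cong (2 +_) (sym (ℕₚ.*-suc 2 (length B))) ⟩
      2 + 2 * suc (length B)      ≡⟨ sym (ℕₚ.*-suc 2 (suc (length B))) ⟩
      2 * suc (suc (length B))    ∎)
    where
    open ℕₚ.≤-Reasoning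
    splitX = link-++⁻ G X₁ aXb
    splitY = link-++⁻ G Y₁ cYd
    X = X₁ ++ x ∷ X₂
    Y = Y₁ ++ y ∷ Y₂
    x∈X : x ∈ X
    x∈X = ∈-++⁺ʳ X₁ (here refl)
    y∈Y : y ∈ Y
    y∈Y = ∈-++⁺ʳ Y₁ (here refl)
    x∉ : x ∉ B
    x∉ x∈ = unique-++-disjoint B (distinct F) x∈ (∈-++⁺ˡ x∈X)
    y∉ : y ∉ B
    y∉ y∈ = unique-++-disjoint B (distinct F) y∈ (∈-++⁺ʳ X (∈-++⁺ˡ y∈Y))
    x≢y : x ≢ y
    x≢y refl = unique-++-disjoint X (unique-++⁻ʳ B (distinct F)) x∈X (∈-++⁺ˡ y∈Y)
    T″ = thread a X₁ x ∷ thread x X₂ b ∷ thread c Y₁ y ∷ thread y Y₂ d ∷ thread x Q y ∷ T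
    xa : KAdj T″ x a
    xa = here (inj₂ (refl , refl))
    xb : KAdj T″ x b
    xb = there (here (inj₁ (refl , refl)))
    yc : KAdj T″ y c
    yc = there (there (here (inj₂ (refl , refl))))
    yd : KAdj T″ y d
    yd = there (there (there (here (inj₁ (refl , refl)))))
    xy : KAdj T″ x y
    xy = there (there (there (there (here (inj₁ (refl , refl))))))
    keep : KAdj T ⇒ KAdj T″
    keep e = there (there (there (there (there e))))
    connected : Off a b c ⊎ Off a b d → Conn3 (y ∷ x ∷ B) (KAdj T″)
    connected (inj₁ (c≢a , c≢b)) =
      conn3-join (unique-++⁻ˡ B (distinct F)) (four F) (conn F) kadj-sym kadj-sym
        a∈ b∈ c∈ d∈ a≢b c≢d c≢a c≢b x∉ y∉ x≢y
        (λ { (here e) → inj₂ (inj₁ e) ; (there (here e)) → inj₂ (inj₂ e) ; (there (there e)) → inj₁ e })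
        (kadj-in goodT) keep xa xb yc yd xy
    connected (inj₂ (d≢a , d≢b)) =
      conn3-join (unique-++⁻ˡ B (distinct F)) (four F) (conn F) kadj-sym kadj-sym
        a∈ b∈ d∈ c∈ a≢b (≢-sym c≢d) d≢a d≢b x∉ y∉ x≢y
        (λ { (here e) → inj₂ (inj₁ e) ; (there (here e)) → inj₂ (inj₂ (ends-swap e))
           ; (there (there e)) → inj₁ e })
        (kadj-in goodT) keep xa xb yd yc xy

  -- Connectivity sees only adjacency, so every use of `P′` can be replaced by `P`. One edge less on
  -- the same branch vertices yields `suc k`.
  frame-drop-parallel : ∀ {B T P P′ k} → Frame G B (P ∷ P′ ∷ T) k →
    (∀ {u w} → Ends (src P′) (tgt P′) u w → Ends (src P) (tgt P) u w) →
    Frame G B (P ∷ T) (suc k)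
  frame-drop-parallel {B} {T} {P} {P′} {k} F par with good F
  ... | gP ∷ _ ∷ goodT = frame
    (unique-++⁻ʳ (inner P′) (unique-↭
      (solve 4 (λ β p p′ δ → β ⊕ p ⊕ p′ ⊕ δ ⊜ p′ ⊕ β ⊕ p ⊕ δ) ↭-refl B (inner P) (inner P′) (inners T))
      (distinct F)))
    (gP ∷ goodT)
    (λ s t u∈ v∈ ou ov → Star.map (λ (e , o) → reroute e , o) (conn F s t u∈ v∈ ou ov))
    (four F)
    (ℕₚ.≤-trans (ℕₚ.≤-reflexive (ℕₚ.+-suc (suc (length T)) k)) (slack F))
    where
    reroute : KAdj (P ∷ P′ ∷ T) ⇒ KAdj (P ∷ T)
    reroute (here e)          = here e
    reroute (there (here e))  = here (par e)
    reroute (there (there e)) = there e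

Trivial : ∀ {n} → List (Thread n) → Set
Trivial = All (λ t → inner t ≡ [])

nontrivial? : ∀ {n} (T : List (Thread n)) → Trivial T ⊎ (∃ λ P → ∃ λ x → P ∈ T × x ∈ inner P)
nontrivial? [] = inj₁ []
nontrivial? (thread a (x ∷ X) b ∷ T) = inj₂ (_ , x , here refl , here refl)
nontrivial? (thread a [] b ∷ T) with nontrivial? T
... | inj₁ tr = inj₁ (refl ∷ tr)
... | inj₂ (P , x , P∈ , x∈) = inj₂ (P , x , there P∈ , x∈)

-- Growing a frame along ears

module _ {n : ℕ} (G : Graph n) where

  -- The termination measure: either `B` grows, which is bounded by `n`, or it does not get smaller
  -- while an edge disappears.
  Shrinks : (B B′ : List (Fin n)) (T T′ : List (Thread n)) → Set
  Shrinks B B′ T T′ = length B < length B′ ⊎ (length B ≤ length B′ × length T′ < length T)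

  record Improved (B : List (Fin n)) (T : List (Thread n)) (k : ℕ) : Set where
    constructor improved
    field
      {B′}    : List (Fin n)
      {T′}    : List (Thread n)
      frame′  : Frame G B′ T′ (suc k)
      shrinks : Shrinks B B′ T T′

  record Attachment (B : List (Fin n)) (T : List (Thread n)) : Set where
    constructor attachment
    field
      {host}   : Thread n
      {rest}   : List (Thread n)
      {x y}    : Fin n
      path     : List (Fin n)
      perm     : T ↭ host ∷ rest
      x∈       : x ∈ inner host
      y∈       : y ∈ B
      y-off    : Off (src host) (tgt host) y
      linked   : Link G x path y
      distinct : Unique path
      fresh    : ∀ {q} → q ∈ path → q ∉ B ++ inners T

module _ {n : ℕ} {G : Graph n} where

  open Frame

  -- If neither end of the second edge lies off the first, the two are parallel and one can go. The
  -- slack rises by one in either case.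
  join-threads : ∀ {B T P P′ k x y} Q → Frame G B (P ∷ P′ ∷ T) k →
    x ∈ inner P → y ∈ inner P′ → Link G x Q y → Unique Q →
    (∀ {q} → q ∈ Q → q ∉ B ++ inners (P ∷ P′ ∷ T)) → Improved G B (P ∷ P′ ∷ T) k
  join-threads {P = thread a _ b} {thread c _ d} Q F x∈ y∈ xQy uQ Q∉
    with ∈-∃++ x∈ | ∈-∃++ y∈ | off? a b c | off? a b d
  ... | X₁ , X₂ , refl | Y₁ , Y₂ , refl | yes oc | _ =
    improved (frame-join X₁ X₂ Y₁ Y₂ Q F (inj₁ oc) xQy uQ Q∉) (inj₁ (ℕₚ.n≤1+n _))
  ... | X₁ , X₂ , refl | Y₁ , Y₂ , refl | no _ | yes od =
    improved (frame-join X₁ X₂ Y₁ Y₂ Q F (inj₂ od) xQy uQ Q∉) (inj₁ (ℕₚ.n≤1+n _))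
  ... | _ | _ | no ¬c | no ¬d =
    improved (frame-drop-parallel F (par (¬off ¬c) (¬off ¬d))) (inj₂ (ℕₚ.≤-refl , ℕₚ.≤-refl))
    where
    c≢d : c ≢ d
    c≢d = case good F of λ { (_ ∷ (_ , _ , c≢d , _) ∷ _) → c≢d }
    par : c ≡ a ⊎ c ≡ b → d ≡ a ⊎ d ≡ b → ∀ {u w} → Ends c d u w → Ends a b u w
    par (inj₁ refl) (inj₁ refl) = ⊥-elim (c≢d refl)
    par (inj₁ refl) (inj₂ refl) = id
    par (inj₂ refl) (inj₁ refl) = ends-swap
    par (inj₂ refl) (inj₂ refl) = ⊥-elim (c≢d refl)

  shrinks-↭ : ∀ {B B′ T₁ T₂ T′} → T₁ ↭ T₂ → Shrinks G B B′ T₁ T′ → Shrinks G B B′ T₂ T′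
  shrinks-↭ p = Sum.map id λ (b , t) → b , subst (_ <_) (Permₚ.↭-length p) t

  -- The ear leaves the thread P because G stays connected without the two ends of P.
  advance : ∀ {B T P x₀ k} → KConnected 3 G → Frame G B T k → P ∈ T → x₀ ∈ inner P →
    Attachment G B T ⊎ Improved G B T k
  advance {B} {T} {P} {x₀} {k} κ F P∈ x₀∈ with ∈-↭ P∈
  ... | R , p = attach found
    where
    a = src P
    b = tgt P
    F′ = frame-↭ p F
    gP = All.head (good F′)
    D = B ++ inner P ++ inners R
    D-unique : Unique (inner P ++ B ++ inners R)
    D-unique = unique-↭ (Permₚ.shifts B (inner P)) (distinct F′)
    x₀-off : Off a b x₀
    x₀-off = (λ { refl → unique-++-disjoint (inner P) D-unique x₀∈ (∈-++⁺ˡ (proj₁ gP)) }) ,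
             (λ { refl → unique-++-disjoint (inner P) D-unique x₀∈ (∈-++⁺ˡ (proj₁ (proj₂ gP))) })
    fourth = pick-fourth (unique-++⁻ˡ B (distinct F)) (four F) a b b
    -- The target `z` is a branch vertex off `a` and `b`, so the walk has to leave the inside of
    -- `P`. The inner vertices of the ear miss `a` and `b` because both lie in `B`; its end misses
    -- them by `end∉`, which later supplies `y-off`.
    found : Ear G (⁅ a ⁆ ∪ ⁅ b ⁆) (inner P) (B ++ inners R)
    found = let (z , z∈ , z≢a , z≢b , _) = fourth in
      find-ear G (path-avoiding-pair κ a b x₀-off (z≢a , z≢b)) x₀∈ (∈-++⁺ˡ z∈)
        (unique-++-disjoint (inner P) D-unique x₀∈)
    attach : Ear G (⁅ a ⁆ ∪ ⁅ b ⁆) (inner P) (B ++ inners R) → Attachment G B T ⊎ Improved G B T k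
    attach (ear {x} {y} Q x∈ y∈ y∉ xQy uQ Q∉X Q∉Y) = place (∈-++⁻ B y∈)
      where
      fresh : ∀ {q} → q ∈ Q → q ∉ D
      fresh q∈ q∈D with ∈-++⁻ B q∈D
      ... | inj₁ r = Q∉Y q∈ (∈-++⁺ˡ r)
      ... | inj₂ r with ∈-++⁻ (inner P) r
      ...   | inj₁ r′ = Q∉X q∈ r′
      ...   | inj₂ r′ = Q∉Y q∈ (∈-++⁺ʳ B r′)
      place : y ∈ B ⊎ y ∈ inners R → Attachment G B T ⊎ Improved G B T k
      place (inj₁ y∈B) = inj₁ (attachment Q p x∈ y∈B (∉⇒off y∉) xQy uQ
        (λ q∈ q∈′ → fresh q∈ (Permₚ.∈-resp-↭ (Permₚ.++⁺ˡ B (inners-↭ p)) q∈′)))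
      place (inj₂ y∈R) with find (∈-concatMap⁻ inner {xs = R} y∈R)
      ... | P′ , P′∈ , y∈P′ with ∈-↭ P′∈
      ...   | R′ , p′ = inj₂ (weaken-perm (join-threads Q (frame-↭ (prep P p′) F′) x∈ y∈P′ xQy uQ
                (λ q∈ q∈′ → fresh q∈ (Permₚ.∈-resp-↭ (↭-sym (Permₚ.++⁺ˡ B (inners-↭ (prep P p′)))) q∈′))))
        where
        weaken-perm : Improved G B (P ∷ P′ ∷ R′) k → Improved G B T k
        weaken-perm (improved {B′} {T′} F″ s) =
          improved F″ (shrinks-↭ {B} {B′} {T′ = T′} (↭-sym (↭-trans p (prep P p′))) s)

  attach-step : ∀ {B T k} → Frame G B T k → (A : Attachment G B T) →
    ∃ λ T′ → Frame G (Attachment.x A ∷ B) T′ k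
  attach-step {B} F (attachment {thread a _ b} Q p x∈ y∈ (y≢a , y≢b) xQy uQ Q∉) with ∈-∃++ x∈
  ... | X₁ , X₂ , refl = _ , frame-subdivide X₁ X₂ Q (frame-↭ p F) y∈ y≢a y≢b xQy uQ
    (λ q∈ q∈′ → Q∉ q∈ (Permₚ.∈-resp-↭ (↭-sym (Permₚ.++⁺ˡ B (inners-↭ p))) q∈′))

  branch-bound : ∀ {B T k} → Frame G B T k → length B ≤ n
  branch-bound {B} F = subst (length B ≤_) (Listₚ.length-tabulate id)
    (unique-⊆-length {ys = allFin n} (unique-++⁻ˡ B (distinct F)) (λ _ → ∈-allFin _))

  -- The recursion is lexicographic: `f` bounds the branch vertices still to come, `g` the number of
  -- edges, and `g` starts afresh whenever `B` grows. Slack gained on the way is given back by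
  -- `frame-weaken`, since only `k` has to survive.
  saturate : ∀ {k} → KConnected 3 G → ∀ f g {B T} → n ≤ f + length B → length T ≤ g →
    Frame G B T k → ∃ λ B′ → ∃ λ T′ → Frame G B′ T′ k × Trivial T′
  saturate κ f g {B} {T} n≤ t≤ F with nontrivial? T
  ... | inj₁ tr = B , T , F , tr
  ... | inj₂ (P , x₀ , P∈ , x₀∈) with advance κ F P∈ x₀∈
  saturate κ zero g n≤ t≤ F | inj₂ _ | inj₁ A =
    ⊥-elim (ℕₚ.<⇒≱ (branch-bound (proj₂ (attach-step F A))) n≤)
  saturate κ (suc f) g {B} n≤ t≤ F | inj₂ _ | inj₁ A =
    saturate κ f _ (subst (n ≤_) (sym (ℕₚ.+-suc f (length B))) n≤) ℕₚ.≤-refl (proj₂ (attach-step F A))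
  saturate κ zero g n≤ t≤ F | inj₂ _ | inj₂ (improved F′ (inj₁ b<)) =
    ⊥-elim (ℕₚ.<⇒≱ (ℕₚ.<-≤-trans b< (branch-bound F′)) n≤)
  saturate κ (suc f) g {B} n≤ t≤ F | inj₂ _ | inj₂ (improved F′ (inj₁ b<)) =
    saturate κ f _ (ℕₚ.≤-trans (subst (n ≤_) (sym (ℕₚ.+-suc f (length B))) n≤) (ℕₚ.+-monoʳ-≤ f b<))
      ℕₚ.≤-refl (frame-weaken F′)
  saturate κ f zero n≤ t≤ F | inj₂ _ | inj₂ (improved F′ (inj₂ (b≤ , t<))) =
    ⊥-elim (ℕₚ.n≮0 (ℕₚ.<-≤-trans t< t≤))
  saturate κ f (suc g) n≤ t≤ F | inj₂ _ | inj₂ (improved F′ (inj₂ (b≤ , t<))) =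
    saturate κ f g (ℕₚ.≤-trans n≤ (ℕₚ.+-monoʳ-≤ f b≤)) (ℕₚ.≤-pred (ℕₚ.≤-trans t< t≤)) (frame-weaken F′)

-- Unsubdivided frames

does-true : {A : Set} (d : Dec A) → does d ≡ true → A
does-true (yes a) _ = a

ends? : ∀ {n} (a b u w : Fin n) → Dec (Ends a b u w)
ends? a b u w = ((u ≟ a) ×-dec (w ≟ b)) ⊎-dec ((u ≟ b) ×-dec (w ≟ a))

kadj? : ∀ {n} (T : List (Thread n)) u w → Dec (KAdj T u w)
kadj? T u w = any? (λ t → ends? (src t) (tgt t) u w) T

elements : ∀ {m} → Subset m → List (Fin m)
elements []          = []
elements (true ∷ p)  = zero ∷ map suc (elements p)
elements (false ∷ p) = map suc (elements p)

length-elements : ∀ {m} (p : Subset m) → length (elements p) ≡ ∣ p ∣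
length-elements []          = refl
length-elements (true ∷ p)  = cong suc (trans (Listₚ.length-map suc (elements p)) (length-elements p))
length-elements (false ∷ p) = trans (Listₚ.length-map suc (elements p)) (length-elements p)

∈-elements⁺ : ∀ {m} (p : Subset m) {i} → i Sub.∈ p → i ∈ elements p
∈-elements⁺ (true ∷ p)  Vec.here       = here refl
∈-elements⁺ (true ∷ p)  (Vec.there i∈) = there (∈-map⁺ suc (∈-elements⁺ p i∈))
∈-elements⁺ (false ∷ p) (Vec.there i∈) = ∈-map⁺ suc (∈-elements⁺ p i∈)

∈-elements⁻ : ∀ {m} (p : Subset m) {i} → i ∈ elements p → i Sub.∈ p
∈-elements⁻ (true ∷ p) (here refl) = Vec.here
∈-elements⁻ (true ∷ p) (there i∈) with ∈-map⁻ suc i∈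
... | _ , j∈ , refl = Vec.there (∈-elements⁻ p j∈)
∈-elements⁻ (false ∷ p) i∈ with ∈-map⁻ suc i∈
... | _ , j∈ , refl = Vec.there (∈-elements⁻ p j∈)

module _ {n : ℕ} {G : Graph n} where

  open Frame

  kadj⇒adj : ∀ {B T} → All (GoodThread G B) T → Trivial T → KAdj T ⇒ Adj G
  kadj⇒adj ((_ , _ , _ , l) ∷ g) (refl ∷ tr) (here (inj₁ (refl , refl))) = l
  kadj⇒adj ((_ , _ , _ , l) ∷ g) (refl ∷ tr) (here (inj₂ (refl , refl))) = adj-sym G l
  kadj⇒adj (_ ∷ g)               (_ ∷ tr)    (there e)                   = kadj⇒adj g tr e

  module _ {B : List (Fin n)} {T : List (Thread n)} {k : ℕ} (F : Frame G B T k) (tr : Trivial T) where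

    private
      at : Fin (length B) → Fin n
      at = lookup B

      at-injective : ∀ {i j} → at i ≡ at j → i ≡ j
      at-injective = lookup-injective (unique-++⁻ˡ B (distinct F)) _ _

      edge : KAdj T ⇒ Adj G
      edge = kadj⇒adj (good F) tr

    -- The vertices are the positions in `B`, as `SubgraphOf` expects an injection from some
    -- `Fin m`. Deciding adjacency by `kadj?` merges parallel edges.
    trivial-graph : Graph (length B)
    trivial-graph = record
      { adj    = λ i j → does (kadj? T (at i) (at j))
      ; sym    = λ i j → Boolₚ.⇔→≡ (mk⇔ (flip i j) (flip j i))
      ; irrefl = λ i → dec-false (kadj? T (at i) (at i)) λ e → adj-irrefl G (edge e) refl
      }
      where
      flip : ∀ i j → does (kadj? T (at i) (at j)) ≡ true → does (kadj? T (at j) (at i)) ≡ true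
      flip i j e = dec-true (kadj? T (at j) (at i)) (kadj-sym (does-true (kadj? T (at i) (at j)) e))

    trivial-subgraph : SubgraphOf trivial-graph G
    trivial-subgraph = record
      { f       = at
      ; f-inj   = at-injective
      ; edges-⊆ = λ i j e → edge (does-true (kadj? T (at i) (at j)) e)
      }

    private
      -- Translates sets of at most two deleted vertices into the pairs of `Conn3`. A singleton is
      -- doubled; for the empty set some vertex other than the two endpoints is deleted, which only
      -- makes the walk harder to find.
      cover : ∀ (S : Subset (length B)) → ∣ S ∣ < 3 → ∀ i j → i Sub.∉ S → j Sub.∉ S →
        ∃ λ s → ∃ λ t → Off s t (at i) × Off s t (at j) × (∀ l → Off s t (at l) → l Sub.∉ S)
      cover S S<3 i j i∉ j∉ = go (elements S) (∈-elements⁺ S) (∈-elements⁻ S)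
        (subst (_< 3) (sym (length-elements S)) S<3)
        where
        apart : ∀ {p q} → p Sub.∉ S → q Sub.∈ S → at p ≢ at q
        apart p∉ q∈ eq with at-injective eq
        ... | refl = p∉ q∈
        go : ∀ es → (∀ {l} → l Sub.∈ S → l ∈ es) → (∀ {l} → l ∈ es → l Sub.∈ S) → length es < 3 →
          ∃ λ s → ∃ λ t → Off s t (at i) × Off s t (at j) × (∀ l → Off s t (at l) → l Sub.∉ S)
        go [] to∈ from∈ _ =
          let (w , _ , w≢i , w≢j , _) = pick-fourth (unique-++⁻ˡ B (distinct F)) (four F) (at i) (at j) (at j)
          in w , w , (≢-sym w≢i , ≢-sym w≢i) , (≢-sym w≢j , ≢-sym w≢j) ,
             λ l _ l∈ → case to∈ l∈ of λ ()
        go (s ∷ []) to∈ from∈ _ = at s , at s , (i≢ , i≢) , (j≢ , j≢) ,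
          λ l (l≢ , _) l∈ → case to∈ l∈ of λ { (here refl) → l≢ refl }
          where
          i≢ = apart i∉ (from∈ (here refl))
          j≢ = apart j∉ (from∈ (here refl))
        go (s ∷ t ∷ []) to∈ from∈ _ = at s , at t ,
          (apart i∉ (from∈ (here refl)) , apart i∉ (from∈ (there (here refl)))) ,
          (apart j∉ (from∈ (here refl)) , apart j∉ (from∈ (there (here refl)))) ,
          λ l (l≢s , l≢t) l∈ → case to∈ l∈ of λ { (here refl) → l≢s refl ; (there (here refl)) → l≢t refl }
        go (_ ∷ _ ∷ _ ∷ _) _ _ (s≤s (s≤s (s≤s ())))

    trivial-3-connected : KConnected 3 trivial-graph
    trivial-3-connected = four F , λ S S<3 i j i∉ j∉ →
      let (s , t , oi , oj , off⇒) = cover S S<3 i j i∉ j∉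
      in walk S off⇒ (conn F s t (∈-lookup i) (∈-lookup j) oi oj) i j refl refl i∉
      where
      walk : ∀ S {s t u v} → (∀ l → Off s t (at l) → l Sub.∉ S) → Star (Avoiding (KAdj T) s t) u v →
        ∀ i j → at i ≡ u → at j ≡ v → i Sub.∉ S → PathAvoiding trivial-graph S i j
      walk S off⇒ ε i j refl eq i∉ with at-injective eq
      ... | refl = here i∉
      walk S {s} {t} off⇒ ((e , _ , ow) ◅ p) i j refl eq i∉ =
        step {w = l} i∉ (dec-true (kadj? T (at i) (at l)) (subst (KAdj T (at i)) w≡ e))
          (walk S off⇒ p l j (sym w≡) eq (off⇒ l (subst (Off s t) w≡ ow)))
        where
        w∈ = proj₂ (kadj-in (good F) e)
        l = Any.index w∈
        w≡ = Anyₚ.lookup-index w∈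

    module _ (sm : SuperMinimallyKConnected 3 G) where

      open DecMem (_≟_ {n}) using (_∈?_)

      private
        not-proper : ¬ Proper trivial-subgraph
        not-proper p = proj₂ sm _ trivial-graph trivial-subgraph p trivial-3-connected

      spanning : ∀ v → v ∈ B
      spanning v = decidable-stable (v ∈? B) λ v∉ →
        not-proper (inj₁ (v , λ i eq → v∉ (subst (_∈ B) eq (∈-lookup i))))

      adj⇒kadj : Adj G ⇒ KAdj T
      adj⇒kadj {u} {v} a = decidable-stable (kadj? T u v) λ ¬e →
        not-proper (inj₂ (u , v , a , λ { (i , j , refl , refl , e) → ¬e (does-true (kadj? T (at i) (at j)) e) }))

-- Subdivided wheels

-- The spoke joins the rim vertex to the hub, the arc joins it to the next rim vertex.
record Sector (n : ℕ) : Set where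
  constructor sector
  field
    rim   : Fin n
    spoke : List (Fin n)
    arc   : List (Fin n)
open Sector public

next : ∀ {n} → Fin n → List (Sector n) → Fin n
next z []      = z
next z (s ∷ _) = rim s

-- Here `z` is the rim vertex at which the last arc ends; with it as a parameter, an open stretch of
-- the rim allows recursion. `wheelThreads` closes the rim by choosing the first rim vertex for `z`,
-- with `h` as the default for the empty list.
wheelFrom : ∀ {n} → Fin n → Fin n → List (Sector n) → List (Thread n)
wheelFrom h z []       = []
wheelFrom h z (s ∷ ss) =
  thread (rim s) (spoke s) h ∷ thread (rim s) (arc s) (next z ss) ∷ wheelFrom h z ss

wheelThreads : ∀ {n} → Fin n → List (Sector n) → List (Thread n)
wheelThreads h ss = wheelFrom h (next h ss) ss

branches : ∀ {n} → Fin n → List (Sector n) → List (Fin n)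
branches h ss = h ∷ map rim ss

vertices : ∀ {n} → Fin n → List (Sector n) → List (Fin n)
vertices h ss = branches h ss ++ inners (wheelThreads h ss)

Linked : ∀ {n} → Graph n → Thread n → Set
Linked G t = Link G (src t) (inner t) (tgt t)

record Wheel {n} (G : Graph n) (h : Fin n) (ss : List (Sector n)) : Set where
  constructor wheel
  field
    distinct : Unique (vertices h ss)
    linked   : All (Linked G) (wheelThreads h ss)
    size     : 3 ≤ length ss

module _ {n : ℕ} where

  next-++ : ∀ (z : Fin n) xs {ys} → next z (xs ++ ys) ≡ next (next z ys) xs
  next-++ z []      = refl
  next-++ z (_ ∷ _) = refl

  wheelFrom-++ : ∀ (h z : Fin n) xs {ys} →
    wheelFrom h z (xs ++ ys) ≡ wheelFrom h (next z ys) xs ++ wheelFrom h z ys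
  wheelFrom-++ h z []            = refl
  wheelFrom-++ h z (s ∷ xs) {ys} = cong₂ (λ w L → thread (rim s) (spoke s) h ∷ thread (rim s) (arc s) w ∷ L)
    (next-++ z xs) (wheelFrom-++ h z xs)

  -- Each block of sectors closes at the first rim vertex of the other block, in both arrangements.
  -- So rotation merely exchanges two blocks of threads.
  rotate-threads : ∀ (h : Fin n) xs ys → wheelThreads h (xs ++ ys) ↭ wheelThreads h (ys ++ xs)
  rotate-threads h []       ys       = ↭-reflexive (cong (wheelThreads h) (sym (Listₚ.++-identityʳ ys)))
  rotate-threads h (x ∷ xs) []       = ↭-reflexive (cong (wheelThreads h) (Listₚ.++-identityʳ (x ∷ xs)))
  rotate-threads h (x ∷ xs) (y ∷ ys) = ↭-trans
    (↭-reflexive (wheelFrom-++ h (rim x) (x ∷ xs)))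
    (↭-trans (Permₚ.++-comm (wheelFrom h (rim y) (x ∷ xs)) (wheelFrom h (rim x) (y ∷ ys)))
      (↭-reflexive (sym (wheelFrom-++ h (rim y) (y ∷ ys)))))

  rotate-rims : ∀ (xs ys : List (Sector n)) → map rim (xs ++ ys) ↭ map rim (ys ++ xs)
  rotate-rims xs ys = Permₚ.map⁺ rim (Permₚ.++-comm xs ys)

  rotate-vertices : ∀ (h : Fin n) xs ys → vertices h (xs ++ ys) ↭ vertices h (ys ++ xs)
  rotate-vertices h xs ys = Permₚ.++⁺ (prep h (rotate-rims xs ys)) (inners-↭ (rotate-threads h xs ys))

  locate : ∀ (h z : Fin n) ss {t} → t ∈ wheelFrom h z ss →
    ∃ λ pre → ∃ λ s → ∃ λ post → ss ≡ pre ++ s ∷ post ×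
      (t ≡ thread (rim s) (spoke s) h ⊎ t ≡ thread (rim s) (arc s) (next z post))
  locate h z (s ∷ ss) (here refl)         = [] , s , ss , refl , inj₁ refl
  locate h z (s ∷ ss) (there (here refl)) = [] , s , ss , refl , inj₂ refl
  locate h z (s ∷ ss) (there (there t∈)) with locate h z ss t∈
  ... | pre , s′ , post , refl , e = s ∷ pre , s′ , post , refl , e

  locate-rim : ∀ (ss : List (Sector n)) {r} → r ∈ map rim ss →
    ∃ λ pre → ∃ λ s → ∃ λ post → ss ≡ pre ++ s ∷ post × r ≡ rim s
  locate-rim ss r∈ with ∈-map⁻ rim r∈
  ... | s , s∈ , refl = let (pre , post , eq) = ∈-∃++ s∈ in pre , s , post , eq , refl

  length-wheelFrom : ∀ (h z : Fin n) ss → length (wheelFrom h z ss) ≡ 2 * length ss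
  length-wheelFrom h z []       = refl
  length-wheelFrom h z (s ∷ ss) = trans (cong (2 +_) (length-wheelFrom h z ss)) (sym (ℕₚ.*-suc 2 (length ss)))

  spoke-edge : ∀ (h z : Fin n) ss {r} → r ∈ map rim ss → KAdj (wheelFrom h z ss) r h
  spoke-edge h z (s ∷ ss) (here refl) = here (inj₁ (refl , refl))
  spoke-edge h z (s ∷ ss) (there r∈)  = there (there (spoke-edge h z ss r∈))

  rim-path : ∀ {E : Fin n → Fin n → Set} h z s ss {p q} → KAdj (wheelFrom h z (s ∷ ss)) ⇒ E →
    (∀ {r} → r ∈ map rim (s ∷ ss) → Off p q r) →
    ∀ {r} → r ∈ map rim (s ∷ ss) → Star (Avoiding E p q) (rim s) r
  rim-path h z s ss        sub off (here refl) = ε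
  rim-path h z s (s′ ∷ ss) sub off (there r∈)  =
    (sub (there (here (inj₁ (refl , refl)))) , off (here refl) , off (there (here refl)))
      ◅ rim-path h z s′ ss (λ e → sub (there (there e))) (λ r∈′ → off (there r∈′)) r∈

  -- If the hub survives, the spokes connect everything to it. If not, at most one rim vertex is
  -- deleted besides, and the rest of the rim stays connected.
  wheel-conn3 : ∀ (h : Fin n) ss → Unique (branches h ss) → Conn3 (branches h ss) (KAdj (wheelThreads h ss))
  wheel-conn3 h ss uq = connect
    where
    E = KAdj (wheelThreads h ss)
    -- Without the hub and t the rim is a path, once it is rotated to start just after t.
    around : ∀ t {u v} → u ∈ map rim ss → v ∈ map rim ss → Off h t u → Off h t v →
      Star (Avoiding E h t) u v
    around t {u} {v} u∈ v∈ (_ , u≢t) (_ , v≢t) with any? (t ≟_) (map rim ss)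
    ... | no t∉ = whole ss id u∈ v∈ λ r∈ → (λ { refl → Uniqueₚ.Unique[x∷xs]⇒x∉xs uq r∈ }) , λ { refl → t∉ r∈ }
      where
      whole : ∀ ss′ → KAdj (wheelFrom h (next h ss) ss′) ⇒ E → u ∈ map rim ss′ → v ∈ map rim ss′ →
        (∀ {r} → r ∈ map rim ss′ → Off h t r) → Star (Avoiding E h t) u v
      whole (s ∷ ss′) sub u∈ v∈ off = avoiding-reverse kadj-sym (rim-path h _ s ss′ sub off u∈)
        ◅◅ rim-path h _ s ss′ sub off v∈
    ... | yes t∈ with locate-rim ss t∈
    ...   | pre , st , post , refl , refl = whole (post ++ pre) id (move u∈ u≢t) (move v∈ v≢t) off
      where
      perm = rotate-rims pre (st ∷ post)
      uq′ : Unique (h ∷ map rim (st ∷ post ++ pre))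
      uq′ = unique-↭ (prep h perm) uq
      move : ∀ {r} → r ∈ map rim (pre ++ st ∷ post) → r ≢ rim st → r ∈ map rim (post ++ pre)
      move r∈ r≢ with Permₚ.∈-resp-↭ perm r∈
      ... | here eq   = ⊥-elim (r≢ eq)
      ... | there r∈′ = r∈′
      off : ∀ {r} → r ∈ map rim (post ++ pre) → Off h (rim st) r
      off r∈ = (λ { refl → Uniqueₚ.Unique[x∷xs]⇒x∉xs uq′ (there r∈) }) ,
        (λ { refl → Uniqueₚ.Unique[x∷xs]⇒x∉xs (AllPairs.tail uq′) r∈ })
      back : KAdj (wheelThreads h (st ∷ post ++ pre)) ⇒ E
      back = Permₚ.Any-resp-↭ (↭-sym (rotate-threads h pre (st ∷ post)))
      whole : ∀ ss′ → KAdj (wheelFrom h (rim st) ss′) ⇒ KAdj (wheelFrom h (rim st) (post ++ pre)) →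
        u ∈ map rim ss′ → v ∈ map rim ss′ →
        (∀ {r} → r ∈ map rim ss′ → Off h (rim st) r) → Star (Avoiding E h (rim st)) u v
      whole (s ∷ ss′) sub u∈ v∈ off = avoiding-reverse kadj-sym (rim-path h _ s ss′ sub′ off u∈)
        ◅◅ rim-path h _ s ss′ sub′ off v∈
        where
        sub′ : KAdj (wheelFrom h (rim st) (s ∷ ss′)) ⇒ E
        sub′ e = back (there (there (sub e)))

    connect : Conn3 (branches h ss) E
    connect s t u∈ v∈ ou ov with off? s t h
    ... | yes oh = to-hub u∈ ou ◅◅ avoiding-reverse kadj-sym (to-hub v∈ ov)
      where
      to-hub : ∀ {u} → u ∈ branches h ss → Off s t u → Star (Avoiding E s t) u h
      to-hub (here refl) _  = ε
      to-hub (there u∈)  ou = (spoke-edge h _ ss u∈ , ou , oh) ◅ ε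
    ... | no ¬oh with ¬off ¬oh
    ...   | inj₁ refl = around t (rim∈ u∈ (proj₁ ou)) (rim∈ v∈ (proj₁ ov)) ou ov
      where
      rim∈ : ∀ {u} → u ∈ branches h ss → u ≢ h → u ∈ map rim ss
      rim∈ (here eq)  u≢ = ⊥-elim (u≢ eq)
      rim∈ (there u∈) _  = u∈
    ...   | inj₂ refl = avoiding-swap
      (around s (rim∈ u∈ (proj₂ ou)) (rim∈ v∈ (proj₂ ov)) (off-swap ou) (off-swap ov))
      where
      rim∈ : ∀ {u} → u ∈ branches h ss → u ≢ h → u ∈ map rim ss
      rim∈ (here eq)  u≢ = ⊥-elim (u≢ eq)
      rim∈ (there u∈) _  = u∈

module _ {n : ℕ} {G : Graph n} where

  -- The condition on `z` keeps the last arc from being a loop. It fails for a closed rim, where `z`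
  -- is the first rim vertex, so `wheel-frame` treats the first sector by hand.
  good-sectors : ∀ {B h z} ss → (∀ {r} → r ∈ map rim ss → r ∈ B) → h ∈ B → z ∈ B →
    Unique (map rim ss) → h ∉ map rim ss → z ∉ map rim ss →
    All (Linked G) (wheelFrom h z ss) → All (GoodThread G B) (wheelFrom h z ss)
  good-sectors [] _ _ _ _ _ _ _ = []
  good-sectors {B} {h} {z} (s ∷ ss) sub h∈ z∈ (r∉ ∷ uq) h∉ z∉ (l ∷ l′ ∷ ls) =
    (sub (here refl) , h∈ , (λ eq → h∉ (here (sym eq))) , l)
    ∷ (sub (here refl) , proj₁ (next∈ ss sub) , proj₂ (next∈ ss sub) (r∉ , z∉) , l′)
    ∷ good-sectors ss (λ r∈ → sub (there r∈)) h∈ z∈ uq (λ p → h∉ (there p)) (λ p → z∉ (there p)) ls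
    where
    next∈ : ∀ ss → (∀ {r} → r ∈ rim s ∷ map rim ss → r ∈ B) →
      next z ss ∈ B × (All (rim s ≢_) (map rim ss) × z ∉ rim s ∷ map rim ss → rim s ≢ next z ss)
    next∈ []      sub = z∈ , λ (_ , z∉) eq → z∉ (here (sym eq))
    next∈ (_ ∷ _) sub = sub (there (here refl)) , λ { (ne ∷ _ , _) → ne }

  -- The constant 2 is exact: `k` spokes mean `2 k` edges on `k + 1` branch vertices.
  wheel-frame : ∀ {h ss} → Wheel G h ss → Frame G (branches h ss) (wheelThreads h ss) 2
  wheel-frame {h} {s ∷ s′ ∷ ss} (wheel uq (l ∷ l′ ∷ ls) size) with unique-++⁻ˡ (branches h (s ∷ s′ ∷ ss)) uq
  ... | h∉ ∷ s∉ ∷ uqr = frame uq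
    ((there (here refl) , here refl , (λ eq → All.head h∉ (sym eq)) , l)
      ∷ (there (here refl) , there (there (here refl)) , All.head s∉ , l′)
      ∷ good-sectors (s′ ∷ ss) (λ r∈ → there (there r∈)) (here refl) (there (here refl)) uqr
          (λ p → All.lookup h∉ (there p) refl) (λ p → All.lookup s∉ p refl) ls)
    (wheel-conn3 h (s ∷ s′ ∷ ss) (h∉ ∷ s∉ ∷ uqr))
    (s≤s (subst (3 ≤_) (sym (Listₚ.length-map rim (s ∷ s′ ∷ ss))) size))
    (ℕₚ.≤-reflexive slack)
    where
    open ≡-Reasoning
    k = length (s ∷ s′ ∷ ss)
    rims = Listₚ.length-map rim (s ∷ s′ ∷ ss)
    slack : length (wheelThreads h (s ∷ s′ ∷ ss)) + 2 ≡ 2 * suc (length (map rim (s ∷ s′ ∷ ss)))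
    slack = begin
      length (wheelThreads h (s ∷ s′ ∷ ss)) + 2    ≡⟨ cong (_+ 2) (length-wheelFrom h (rim s) (s ∷ s′ ∷ ss)) ⟩
      2 * k + 2                                    ≡⟨ ℕₚ.+-comm (2 * k) 2 ⟩
      2 + 2 * k                                    ≡⟨ sym (ℕₚ.*-suc 2 k) ⟩
      2 * suc k                                    ≡⟨ cong (λ l → 2 * suc l) (sym rims) ⟩
      2 * suc (length (map rim (s ∷ s′ ∷ ss)))     ∎
  wheel-frame {ss = _ ∷ []} (wheel _ _ (s≤s ()))

  rotate : ∀ {h} xs ys → Wheel G h (xs ++ ys) → Wheel G h (ys ++ xs)
  rotate {h} xs ys (wheel uq ls size) = wheel
    (unique-↭ (rotate-vertices h xs ys) uq)
    (Permₚ.All-resp-↭ (rotate-threads h xs ys) ls)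
    (subst (3 ≤_) (Permₚ.↭-length (Permₚ.++-comm xs ys)) size)

  -- The ear becomes the spoke of the new rim vertex `x`, which cuts the arc into two.
  grow : ∀ {h r p x} X₁ X₂ Q {ss} → Wheel G h (sector r p (X₁ ++ x ∷ X₂) ∷ ss) →
    Link G x Q h → Unique Q → (∀ {q} → q ∈ Q → q ∉ vertices h (sector r p (X₁ ++ x ∷ X₂) ∷ ss)) →
    Wheel G h (sector r p X₁ ∷ sector x Q X₂ ∷ ss)
  grow {h} {r} {p} {x} X₁ X₂ Q {ss} (wheel uq (l ∷ l′ ∷ ls) size) xQh uQ Q∉ = wheel
    (unique-↭
      (solve 9 (λ q η ρ ρs σ x₁ ξ x₂ δ →
          q ⊕ (η ⊕ ρ ⊕ ρs) ⊕ (σ ⊕ (x₁ ⊕ ξ ⊕ x₂) ⊕ δ) ⊜ (η ⊕ ρ ⊕ ξ ⊕ ρs) ⊕ (σ ⊕ x₁ ⊕ q ⊕ x₂ ⊕ δ))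
        ↭-refl Q [ h ] [ r ] (map rim ss) p X₁ [ x ] X₂ (inners (wheelFrom h r ss)))
      (Uniqueₚ.++⁺ uQ uq (λ (q∈ , q∈′) → Q∉ q∈ q∈′)))
    (l ∷ proj₁ (link-++⁻ G X₁ l′) ∷ xQh ∷ proj₂ (link-++⁻ G X₁ l′) ∷ ls)
    (ℕₚ.≤-trans size (ℕₚ.n≤1+n _))

-- Ears on a subdivided wheel

module _ {n : ℕ} {G : Graph n} where

  -- The slack is one more than that of a wheel, and `saturate` preserves it; this gives the strict
  -- inequality.
  Strict : Set
  Strict = ∃ λ B → ∃ λ T → Frame G B T 3

  grow-at : ∀ {h s ss x Q} → Wheel G h (s ∷ ss) → x ∈ arc s → Link G x Q h → Unique Q →
    (∀ {q} → q ∈ Q → q ∉ vertices h (s ∷ ss)) →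
    ∃ λ ss′ → Wheel G h ss′ × length ss′ ≡ suc (length (s ∷ ss))
  grow-at {Q = Q} w x∈ xQh uQ Q∉ with ∈-∃++ x∈
  ... | X₁ , X₂ , refl = _ , grow X₁ X₂ Q w xQh uQ Q∉ , refl

  -- The three edges at the new hub `rim s₂` become spokes, and the triangle on the other three
  -- branch vertices becomes the rim. The two versions run round this triangle in opposite
  -- directions, so that each of `spoke s₁`, `arc s₃`, `spoke s₃` occurs unreversed as an arc in one
  -- of them.
  rehubbed mirrored : Fin n → (s₁ s₂ s₃ : Sector n) → List (Sector n)
  rehubbed h s₁ s₂ s₃ = sector (rim s₃) (reverse (arc s₂)) (arc s₃)
    ∷ sector (rim s₁) (arc s₁) (spoke s₁) ∷ sector h (reverse (spoke s₂)) (reverse (spoke s₃)) ∷ []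
  mirrored h s₁ s₂ s₃ = sector (rim s₃) (reverse (arc s₂)) (spoke s₃)
    ∷ sector h (reverse (spoke s₂)) (reverse (spoke s₁)) ∷ sector (rim s₁) (arc s₁) (reverse (arc s₃)) ∷ []

  rehubbed-vertices : ∀ h s₁ s₂ s₃ →
    vertices (rim s₂) (rehubbed h s₁ s₂ s₃) ↭ vertices h (s₁ ∷ s₂ ∷ s₃ ∷ [])
  rehubbed-vertices h (sector r p₁ q₁) (sector y p q) (sector u p₂ q₂) = ↭-trans
    (Permₚ.++⁺ˡ (y ∷ u ∷ r ∷ h ∷ []) (Permₚ.++⁺ (Permₚ.↭-reverse q) (Permₚ.++⁺ˡ q₂ (Permₚ.++⁺ˡ q₁ (Permₚ.++⁺ˡ p₁
      (Permₚ.++⁺ (Permₚ.↭-reverse p) (Permₚ.++⁺ʳ [] (Permₚ.↭-reverse p₂))))))))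
    (solve 10 (λ η ρ ψ υ π κ π₁ κ₁ π₂ κ₂ →
        (ψ ⊕ υ ⊕ ρ ⊕ η) ⊕ κ ⊕ κ₂ ⊕ κ₁ ⊕ π₁ ⊕ π ⊕ π₂ ⊕ ∅ ⊜ (η ⊕ ρ ⊕ ψ ⊕ υ) ⊕ π₁ ⊕ κ₁ ⊕ π ⊕ κ ⊕ π₂ ⊕ κ₂ ⊕ ∅)
      ↭-refl [ h ] [ r ] [ y ] [ u ] p q p₁ q₁ p₂ q₂)

  mirrored-vertices : ∀ h s₁ s₂ s₃ →
    vertices (rim s₂) (mirrored h s₁ s₂ s₃) ↭ vertices h (s₁ ∷ s₂ ∷ s₃ ∷ [])
  mirrored-vertices h (sector r p₁ q₁) (sector y p q) (sector u p₂ q₂) = ↭-trans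
    (Permₚ.++⁺ˡ (y ∷ u ∷ h ∷ r ∷ []) (Permₚ.++⁺ (Permₚ.↭-reverse q) (Permₚ.++⁺ˡ p₂ (Permₚ.++⁺ (Permₚ.↭-reverse p)
      (Permₚ.++⁺ (Permₚ.↭-reverse p₁) (Permₚ.++⁺ˡ q₁ (Permₚ.++⁺ʳ [] (Permₚ.↭-reverse q₂))))))))
    (solve 10 (λ η ρ ψ υ π κ π₁ κ₁ π₂ κ₂ →
        (ψ ⊕ υ ⊕ η ⊕ ρ) ⊕ κ ⊕ π₂ ⊕ π ⊕ π₁ ⊕ κ₁ ⊕ κ₂ ⊕ ∅ ⊜ (η ⊕ ρ ⊕ ψ ⊕ υ) ⊕ π₁ ⊕ κ₁ ⊕ π ⊕ κ ⊕ π₂ ⊕ κ₂ ⊕ ∅)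
      ↭-refl [ h ] [ r ] [ y ] [ u ] p q p₁ q₁ p₂ q₂)

  rehub : ∀ {h s₁ s₂ s₃} → Wheel G h (s₁ ∷ s₂ ∷ s₃ ∷ []) → Wheel G (rim s₂) (rehubbed h s₁ s₂ s₃)
  rehub {h} {s₁} {s₂} {s₃} (wheel uq (l₁ ∷ l₂ ∷ l₃ ∷ l₄ ∷ l₅ ∷ l₆ ∷ []) size) = wheel
    (unique-↭ (↭-sym (rehubbed-vertices h s₁ s₂ s₃)) uq)
    (link-reverse G (arc s₂) l₄ ∷ l₆ ∷ l₂ ∷ l₁
      ∷ link-reverse G (spoke s₂) l₃ ∷ link-reverse G (spoke s₃) l₅ ∷ [])
    size

  rehub-mirror : ∀ {h s₁ s₂ s₃} → Wheel G h (s₁ ∷ s₂ ∷ s₃ ∷ []) → Wheel G (rim s₂) (mirrored h s₁ s₂ s₃)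
  rehub-mirror {h} {s₁} {s₂} {s₃} (wheel uq (l₁ ∷ l₂ ∷ l₃ ∷ l₄ ∷ l₅ ∷ l₆ ∷ []) size) = wheel
    (unique-↭ (↭-sym (mirrored-vertices h s₁ s₂ s₃)) uq)
    (link-reverse G (arc s₂) l₄ ∷ l₅ ∷ link-reverse G (spoke s₂) l₃
      ∷ link-reverse G (spoke s₁) l₁ ∷ l₂ ∷ link-reverse G (arc s₃) l₆ ∷ [])
    size

  -- In a subdivided K₄ every branch vertex can serve as the hub.
  attach-k4 : ∀ {h s₁ s₂ s₃ P x Q} → Wheel G h (s₁ ∷ s₂ ∷ s₃ ∷ []) →
    P ∈ wheelThreads h (s₁ ∷ s₂ ∷ s₃ ∷ []) → x ∈ inner P → Off (src P) (tgt P) (rim s₂) →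
    Link G x Q (rim s₂) → Unique Q → (∀ {q} → q ∈ Q → q ∉ vertices h (s₁ ∷ s₂ ∷ s₃ ∷ [])) →
    ∃ λ h′ → ∃ λ ss′ → Wheel G h′ ss′ × length ss′ ≡ 4
  attach-k4 {h} {s₁} {s₂} {s₃} w (here refl) x∈ off xQy uQ Q∉ = _ ,
    grow-at (rotate (first ∷ []) others (rehub w)) x∈ xQy uQ
      (λ q∈ q∈′ → Q∉ q∈ (Permₚ.∈-resp-↭ (rehubbed-vertices h s₁ s₂ s₃)
        (Permₚ.∈-resp-↭ (rotate-vertices (rim s₂) others (first ∷ [])) q∈′)))
    where
    first = sector (rim s₃) (reverse (arc s₂)) (arc s₃)
    others = sector (rim s₁) (arc s₁) (spoke s₁) ∷ sector h (reverse (spoke s₂)) (reverse (spoke s₃)) ∷ []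
  attach-k4 w (there (here refl)) x∈ off xQy uQ Q∉ = ⊥-elim (proj₂ off refl)
  attach-k4 w (there (there (here refl))) x∈ off xQy uQ Q∉ = ⊥-elim (proj₁ off refl)
  attach-k4 w (there (there (there (here refl)))) x∈ off xQy uQ Q∉ = ⊥-elim (proj₁ off refl)
  attach-k4 {h} {s₁} {s₂} {s₃} w (there (there (there (there (here refl))))) x∈ off xQy uQ Q∉ = _ ,
    grow-at (rehub-mirror w) x∈ xQy uQ
      (λ q∈ q∈′ → Q∉ q∈ (Permₚ.∈-resp-↭ (mirrored-vertices h s₁ s₂ s₃) q∈′))
  attach-k4 {h} {s₁} {s₂} {s₃} w (there (there (there (there (there (here refl)))))) x∈ off xQy uQ Q∉ = _ ,
    grow-at (rehub w) x∈ xQy uQ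
      (λ q∈ q∈′ → Q∉ q∈ (Permₚ.∈-resp-↭ (rehubbed-vertices h s₁ s₂ s₃) q∈′))

  merge : (s₁ s₂ : Sector n) → Sector n
  merge s₁ s₂ = sector (rim s₁) (spoke s₁) (arc s₁ ++ rim s₂ ∷ arc s₂)

  merge-vertices : ∀ h s₁ s₂ ss → vertices h (merge s₁ s₂ ∷ ss) ++ spoke s₂ ↭ vertices h (s₁ ∷ s₂ ∷ ss)
  merge-vertices h (sector r p₁ q₁) (sector y p q) ss =
    solve 9 (λ η ρ ψ π κ π₁ κ₁ ρs δ →
        ((η ⊕ ρ ⊕ ρs) ⊕ π₁ ⊕ (κ₁ ⊕ ψ ⊕ κ) ⊕ δ) ⊕ π ⊜ (η ⊕ ρ ⊕ ψ ⊕ ρs) ⊕ π₁ ⊕ κ₁ ⊕ π ⊕ κ ⊕ δ)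
      ↭-refl [ h ] [ r ] [ y ] p q p₁ q₁ (map rim ss) (inners (wheelFrom h r ss))

  -- The vertex `rim s₂` turns into an inner vertex of the merged arc. The bound on `ss` leaves
  -- three spokes, so the result is again a wheel and has slack 2.
  delete-spoke : ∀ {h s₁ s₂} ss → 2 ≤ length ss → Wheel G h (s₁ ∷ s₂ ∷ ss) → Wheel G h (merge s₁ s₂ ∷ ss)
  delete-spoke {h} {s₁} {s₂} ss 2≤ (wheel uq (l₁ ∷ l₂ ∷ _ ∷ l₃ ∷ ls) _) = wheel
    (unique-++⁻ˡ _ (unique-↭ (↭-sym (merge-vertices h s₁ s₂ ss)) uq))
    (l₁ ∷ link-++⁺ G (arc s₁) l₂ l₃ ∷ ls)
    (s≤s 2≤)

  -- Deleting the spoke at the rim vertex where the ear ends makes the ear run between inner vertices of two edges.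
  attach-rim : ∀ {h s₁ s₂ ss P x Q} → 2 ≤ length ss → Wheel G h (s₁ ∷ s₂ ∷ ss) →
    P ∈ wheelThreads h (s₁ ∷ s₂ ∷ ss) → x ∈ inner P → Off (src P) (tgt P) (rim s₂) →
    Link G x Q (rim s₂) → Unique Q → (∀ {q} → q ∈ Q → q ∉ vertices h (s₁ ∷ s₂ ∷ ss)) → Strict
  attach-rim {h} {s₁} {s₂} {ss} {P} {x} {Q} 2≤ w P∈ x∈ off xQy uQ Q∉ = from-rest (rest P∈)
    where
    merged = thread (rim s₁) (arc s₁ ++ rim s₂ ∷ arc s₂) (next (rim s₁) ss)
    T′ = wheelThreads h (merge s₁ s₂ ∷ ss)
    -- The edges affected by the deletion, namely the first arc and both threads of `s₂`, end in
    -- `rim s₂` and are excluded by `off`. Hence the host `P` survives the deletion unchanged.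
    rest : P ∈ wheelThreads h (s₁ ∷ s₂ ∷ ss) → ∃ λ R → T′ ↭ P ∷ merged ∷ R
    rest (here refl)                         = _ , ↭-refl
    rest (there (here refl))                 = ⊥-elim (proj₂ off refl)
    rest (there (there (here refl)))         = ⊥-elim (proj₁ off refl)
    rest (there (there (there (here refl)))) = ⊥-elim (proj₁ off refl)
    rest (there (there (there (there P∈′)))) with ∈-↭ P∈′
    ... | R , p = thread (rim s₁) (spoke s₁) h ∷ R ,
      ↭-trans (prep _ (prep merged p)) (↭-trans (prep _ (swap merged P ↭-refl))
        (↭-trans (swap _ P ↭-refl) (prep P (swap _ merged ↭-refl))))
    from-rest : (∃ λ R → T′ ↭ P ∷ merged ∷ R) → Strict
    -- The vertex `rim s₂` is now inside `merged`, and either outcome of `join-threads` raises the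
    -- slack of the smaller wheel from 2 to 3.
    from-rest (R , perm) with join-threads Q (frame-↭ perm (wheel-frame (delete-spoke ss 2≤ w)))
      x∈ (∈-++⁺ʳ (arc s₁) (here refl)) xQy uQ
      (λ q∈ q∈′ → Q∉ q∈ (Permₚ.∈-resp-↭ (merge-vertices h s₁ s₂ ss) (∈-++⁺ˡ
        (Permₚ.∈-resp-↭ (Permₚ.++⁺ˡ (branches h (s₁ ∷ ss)) (inners-↭ (↭-sym perm))) q∈′))))
    ... | improved F _ = _ , _ , F

  WheelIn : Set
  WheelIn = ∃ λ h → ∃ λ ss → Wheel G h ss × Trivial (wheelThreads h ss)

  enlarge : ∀ {h ss} → Wheel G h ss → Attachment G (branches h ss) (wheelThreads h ss) →
    Strict ⊎ (∃ λ h′ → ∃ λ ss′ → Wheel G h′ ss′ × length ss′ ≡ suc (length ss))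
  enlarge {h} {ss} w (attachment {P} {R} {x} Q perm x∈ (here refl) off xQy uQ Q∉) =
    at-hub (locate h (next h ss) ss (Permₚ.∈-resp-↭ (↭-sym perm) (here refl)))
    where
    at-hub : _ → _
    at-hub (pre , s , post , refl , inj₁ refl) = ⊥-elim (proj₂ off refl)
    at-hub (pre , s , post , refl , inj₂ refl)
      with grow-at (rotate pre (s ∷ post) w) x∈ xQy uQ
             (λ q∈ q∈′ → Q∉ q∈ (Permₚ.∈-resp-↭ (rotate-vertices h (s ∷ post) pre) q∈′))
    ... | ss′ , w′ , len = inj₂
      (h , ss′ , w′ , trans len (cong suc (Permₚ.↭-length (Permₚ.++-comm (s ∷ post) pre))))
  enlarge {h} w (attachment {P} {R} {x} Q perm x∈ (there y∈) off xQy uQ Q∉) with locate-rim _ y∈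
  ... | pre , s , post , refl , refl = at-rim (post ++ pre) (rotate pre (s ∷ post) w)
    (Permₚ.∈-resp-↭ (↭-trans (↭-sym perm) (rotate-threads h pre (s ∷ post))) (here refl))
    (λ q∈ q∈′ → Q∉ q∈ (Permₚ.∈-resp-↭ (rotate-vertices h (s ∷ post) pre) q∈′))
    (Permₚ.↭-length (Permₚ.++-comm (s ∷ post) pre))
    where
    second : ∀ t M → Wheel G h (t ∷ s ∷ M) → P ∈ wheelThreads h (t ∷ s ∷ M) →
      (∀ {q} → q ∈ Q → q ∉ vertices h (t ∷ s ∷ M)) →
      Strict ⊎ (∃ λ h′ → ∃ λ ss′ → Wheel G h′ ss′ × length ss′ ≡ suc (length (t ∷ s ∷ M)))
    second t []           (wheel _ _ (s≤s (s≤s ()))) P∈ Q∉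
    second t (u ∷ [])     w P∈ Q∉ = inj₂ (attach-k4 w P∈ x∈ off xQy uQ Q∉)
    second t (u ∷ v ∷ M)  w P∈ Q∉ = inj₁ (attach-rim (s≤s (s≤s z≤n)) w P∈ x∈ off xQy uQ Q∉)
    -- The edges at `rim s` are the spoke and arc of `s` and the arc of the sector before it. The
    -- last sector is rotated to the front, so that all three belong to the first two sectors.
    at-rim : ∀ M {l} → Wheel G h (s ∷ M) → P ∈ wheelThreads h (s ∷ M) →
      (∀ {q} → q ∈ Q → q ∉ vertices h (s ∷ M)) → length (s ∷ M) ≡ l →
      Strict ⊎ (∃ λ h′ → ∃ λ ss′ → Wheel G h′ ss′ × length ss′ ≡ suc l)
    at-rim M w P∈ Q∉ len with initLast M
    at-rim .[] (wheel _ _ (s≤s ())) P∈ Q∉ len | []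
    at-rim .(M ++ [ t ]) w P∈ Q∉ refl | M ∷ʳ′ t with second t M (rotate (s ∷ M) [ t ] w)
      (Permₚ.∈-resp-↭ (rotate-threads h (s ∷ M) [ t ]) P∈)
      (λ q∈ q∈′ → Q∉ q∈ (Permₚ.∈-resp-↭ (rotate-vertices h [ t ] (s ∷ M)) q∈′))
    ... | inj₁ st = inj₁ st
    ... | inj₂ (h′ , ss′ , w′ , len′) =
      inj₂ (h′ , ss′ , w′ , trans len′ (cong suc (Permₚ.↭-length (Permₚ.++-comm [ t ] (s ∷ M)))))

  wheel-bound : ∀ {h ss} → Wheel G h ss → length ss < n
  wheel-bound {h} {ss} w = subst (λ l → suc l ≤ n) (Listₚ.length-map rim ss) (branch-bound (wheel-frame w))

  -- Each round without a strict frame adds a spoke, and a wheel in `G` has fewer than `n` spokes;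
  -- `f` counts the spokes still possible.
  wheel-or-strict : KConnected 3 G → ∀ f {h ss} → n ≤ f + length ss → Wheel G h ss → WheelIn ⊎ Strict
  wheel-or-strict κ f {h} {ss} n≤ w with nontrivial? (wheelThreads h ss)
  ... | inj₁ tr = inj₁ (h , ss , w , tr)
  ... | inj₂ (P , x , P∈ , x∈) with advance κ (wheel-frame w) P∈ x∈
  ...   | inj₂ (improved F _) = inj₂ (_ , _ , F)
  ...   | inj₁ A with enlarge w A
  ...     | inj₁ st = inj₂ st
  wheel-or-strict κ zero    n≤ w | inj₂ _ | inj₁ A | inj₂ _ = ⊥-elim (ℕₚ.<⇒≱ (wheel-bound w) n≤)
  wheel-or-strict κ (suc f) n≤ w | inj₂ _ | inj₁ A | inj₂ (h′ , ss′ , w′ , len) =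
    wheel-or-strict κ f (ℕₚ.≤-trans n≤ (ℕₚ.≤-reflexive (trans (sym (ℕₚ.+-suc f _)) (cong (f +_) (sym len))))) w′

-- The initial wheel

Chain : ∀ {n} → Graph n → Fin n → List (Fin n) → Set
Chain G v []      = ⊤
Chain G v (w ∷ L) = Adj G v w × Chain G w L

chain-++⁻ : ∀ {n} {G : Graph n} {v u} X {Y} → Chain G v (X ++ u ∷ Y) → Link G v X u × Chain G u Y
chain-++⁻ []      (a , c) = a , c
chain-++⁻ (x ∷ X) (a , c) = let (l , c′) = chain-++⁻ X c in (a , l) , c′

-- It is not known which of `a` and `b` occurs first, so they are returned in list order as `u` and
-- `w`. The grouping `Y ++ [ w ]` is the second side of the cycle to be built.
two-members : {A : Set} {a b : A} (P : A → Set) (L : List A) → P a → P b → a ≢ b → a ∈ L → b ∈ L →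
  ∃ λ X → ∃ λ u → ∃ λ Y → ∃ λ w → ∃ λ Z → L ≡ X ++ u ∷ (Y ++ [ w ]) ++ Z × P u × P w
two-members {a = a} {b} P L pa pb a≢b a∈ b∈ with ∈-∃++ a∈
... | X , M , refl with ∈-++⁻ X b∈
...   | inj₂ (here eq) = ⊥-elim (a≢b (sym eq))
...   | inj₂ (there b∈M) with ∈-∃++ b∈M
...     | Y , Z , refl = X , a , Y , b , Z , cong (λ W → X ++ a ∷ W) (sym (Listₚ.++-assoc Y [ b ] Z)) , pa , pb
two-members {a = a} {b} P L pa pb a≢b a∈ b∈ | X , M , refl | inj₁ b∈X with ∈-∃++ b∈X
... | W , Y , refl = W , b , Y , a , M ,
  trans (Listₚ.++-assoc W (b ∷ Y) (a ∷ M)) (cong (λ V → W ++ b ∷ V) (sym (Listₚ.++-assoc Y [ a ] M))) , pb , pa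

module _ {n : ℕ} {G : Graph n} (κ : KConnected 3 G) where

  open DecMem (_≟_ {n}) using (_∈?_)

  fresh-vertex : ∀ a b c → ∃ λ w → w ≢ a × w ≢ b × w ≢ c
  fresh-vertex a b c =
    let (w , _ , ne) = pick-fourth (Uniqueₚ.allFin⁺ n)
                         (subst (4 ≤_) (sym (Listₚ.length-tabulate id)) (proj₁ κ)) a b c
    in w , ne

  neighbour-off : ∀ {v} a b → Off a b v → ∃ λ w → Adj G v w × Off a b w
  neighbour-off {v} a b ov with fresh-vertex v a b
  ... | z , z≢v , oz with path-avoiding-pair κ a b ov oz
  ...   | here _     = ⊥-elim (z≢v refl)
  ...   | step _ e p = _ , e , ∉⇒off (path-start G {X = []} {Y = []} p)

  -- Only maximality at the front end `v` is sought: the path is extended there as long as `v` has a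
  -- neighbour outside it.
  longest-path : ∀ f {v L} → n ≤ f + length L → Chain G v L → Unique (v ∷ L) →
    ∃ λ v → ∃ λ L → Chain G v L × Unique (v ∷ L) × (∀ {w} → Adj G v w → w ∈ L)
  longest-path f {v} {L} n≤ c uq with Finₚ.any? (λ w → (adj G v w Boolₚ.≟ true) ×-dec ¬? (w ∈? (v ∷ L)))
  ... | no none = v , L , c , uq , λ {w} e → inside e (decidable-stable (w ∈? (v ∷ L)) λ w∉ → none (w , e , w∉))
    where
    inside : ∀ {w} → Adj G v w → w ∈ v ∷ L → w ∈ L
    inside e (here refl) = ⊥-elim (adj-irrefl G e refl)
    inside e (there w∈)  = w∈
  longest-path zero {v} {L} n≤ c uq | yes (w , e , w∉) = ⊥-elim (ℕₚ.<⇒≱ too-long n≤)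
    where
    too-long : length (v ∷ L) ≤ n
    too-long = subst (length (v ∷ L) ≤_) (Listₚ.length-tabulate id)
      (unique-⊆-length {ys = allFin n} uq (λ _ → ∈-allFin _))
  longest-path (suc f) n≤ c uq | yes (w , e , w∉) =
    longest-path f (ℕₚ.≤-trans n≤ (ℕₚ.≤-reflexive (sym (ℕₚ.+-suc f _)))) (adj-sym G e , c)
      (Allₚ.¬Any⇒All¬ _ w∉ ∷ uq)

  -- The members `a` and `c` make both sides of the cycle nonempty. So after the deletion of `v` and
  -- `u` there are vertices on each side for an ear to connect.
  record CycleWithChord : Set where
    constructor cycle-with-chord
    field
      {v u a c}     : Fin n
      left right    : List (Fin n)
      a∈            : a ∈ left
      c∈            : c ∈ right
      distinct      : Unique (v ∷ left ++ u ∷ right)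
      left-linked   : Link G v left u
      right-linked  : Link G u right v
      chord         : Adj G u v

  -- All neighbours of the first vertex v of a longest path lie on the path; besides the second
  -- vertex there are two more, u and w, so the path closes at w to a cycle with the chord v u.
  find-cycle-with-chord : CycleWithChord
  find-cycle-with-chord with longest-path n {v₀} {[]} (ℕₚ.m≤m+n n 0) tt ([] ∷ [])
    where
    v₀ : Fin n
    v₀ = fromℕ< (ℕₚ.≤-trans (s≤s z≤n) (proj₁ κ))
  ... | v , [] , _ , _ , all-in =
    let (b , b≢ , _) = fresh-vertex v v v
        (w , e , _)  = neighbour-off b b (≢-sym b≢ , ≢-sym b≢)
    in case all-in e of λ ()
  ... | v , v₁ ∷ M , c , uq , all-in
    with neighbour-off v₁ v₁ (All.head (AllPairs.head uq) , All.head (AllPairs.head uq))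
  ...   | a , va , a≢v₁ , _ with neighbour-off v₁ a (All.head (AllPairs.head uq) , adj-irrefl G va)
  ...     | b , vb , b≢v₁ , b≢a
    with two-members (Adj G v) M va vb (≢-sym b≢a) (later (all-in va) a≢v₁) (later (all-in vb) b≢v₁)
    where
    later : ∀ {w} → w ∈ v₁ ∷ M → w ≢ v₁ → w ∈ M
    later (here eq)  ne = ⊥-elim (ne eq)
    later (there w∈) _  = w∈
  ...       | X , u , Y , w , Z , refl , vu , vw = cycle-with-chord (v₁ ∷ X) (Y ++ [ w ])
    (here refl) (∈-++⁺ʳ Y (here refl))
    (unique-++⁻ˡ (v ∷ v₁ ∷ X ++ u ∷ Y ++ [ w ])
      (subst (λ W → Unique (v ∷ v₁ ∷ W)) (sym (Listₚ.++-assoc X (u ∷ Y ++ [ w ]) Z)) uq))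
    (proj₁ (chain-++⁻ (v₁ ∷ X) c))
    (link-++⁺ G Y
      (proj₁ (chain-++⁻ Y (subst (Chain G u) (Listₚ.++-assoc Y [ w ] Z) (proj₂ (chain-++⁻ (v₁ ∷ X) c)))))
      (adj-sym G vw))
    (adj-sym G vu)

  -- An ear crossing the chord v u completes the cycle to a subdivided K₄.
  initial-wheel : ∃ λ h → ∃ λ ss → Wheel G h ss
  initial-wheel with find-cycle-with-chord
  ... | cycle-with-chord {v} {u} {a} {c} A C a∈ c∈ uq lA lC uv = build found
    where
    A∩ : ∀ {p} → p ∈ A → p ∉ u ∷ C
    A∩ = unique-++-disjoint A (AllPairs.tail uq)
    v∉ : v ∉ A ++ u ∷ C
    v∉ = Uniqueₚ.Unique[x∷xs]⇒x∉xs uq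
    u∉C : u ∉ C
    u∉C = Uniqueₚ.Unique[x∷xs]⇒x∉xs (unique-++⁻ʳ A (AllPairs.tail uq))
    C∩ : ∀ {p} → p ∈ C → p ∉ v ∷ u ∷ A
    C∩ p∈ (here refl)         = v∉ (∈-++⁺ʳ A (there p∈))
    C∩ p∈ (there (here refl)) = u∉C p∈
    C∩ p∈ (there (there p∈A)) = A∩ p∈A (there p∈)
    found : Ear G (⁅ v ⁆ ∪ ⁅ u ⁆) C (v ∷ u ∷ A)
    found = find-ear G
      (path-avoiding-pair κ v u
        ((λ { refl → C∩ c∈ (here refl) }) , (λ { refl → u∉C c∈ }))
        ((λ { refl → v∉ (∈-++⁺ˡ a∈) }) , (λ { refl → A∩ a∈ (here refl) })))
      c∈ (there (there a∈)) (C∩ c∈)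
    build : Ear G (⁅ v ⁆ ∪ ⁅ u ⁆) C (v ∷ u ∷ A) → ∃ λ h → ∃ λ ss → Wheel G h ss
    build (ear Q x∈ (here refl) y∉ _ _ _ _) = ⊥-elim (proj₁ (∉⇒off y∉) refl)
    build (ear Q x∈ (there (here refl)) y∉ _ _ _ _) = ⊥-elim (proj₂ (∉⇒off y∉) refl)
    build (ear {x} {y} Q x∈ (there (there y∈)) y∉ xQy uQ Q∉C Q∉A) with ∈-∃++ x∈ | ∈-∃++ y∈
    ... | C₁ , C₂ , refl | A₁ , A₂ , refl =
      -- The hub is `v` and the rim passes through `y`, `u`, `x`. The chord is the spoke at `u`,
      -- with no inner vertex, and the ear is the arc from `x` back to `y`.
      v , sector y (reverse A₁) A₂ ∷ sector u [] C₁ ∷ sector x C₂ Q ∷ [] , wheel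
        (unique-↭ perm (Uniqueₚ.++⁺ uQ uq λ (q∈ , q∈′) → fresh q∈ q∈′))
        (link-reverse G A₁ (proj₁ (link-++⁻ G A₁ lA)) ∷ proj₂ (link-++⁻ G A₁ lA)
          ∷ uv ∷ proj₁ (link-++⁻ G C₁ lC) ∷ proj₂ (link-++⁻ G C₁ lC) ∷ xQy ∷ [])
        ℕₚ.≤-refl
      where
      fresh : ∀ {q} → q ∈ Q → q ∉ v ∷ (A₁ ++ y ∷ A₂) ++ u ∷ (C₁ ++ x ∷ C₂)
      fresh q∈ (here refl) = Q∉A q∈ (here refl)
      fresh q∈ (there q∈′) with ∈-++⁻ (A₁ ++ y ∷ A₂) q∈′
      ... | inj₁ q∈A           = Q∉A q∈ (there (there q∈A))
      ... | inj₂ (here refl)   = Q∉A q∈ (there (here refl))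
      ... | inj₂ (there q∈C)   = Q∉C q∈ q∈C
      perm : Q ++ v ∷ (A₁ ++ y ∷ A₂) ++ u ∷ (C₁ ++ x ∷ C₂) ↭
        vertices v (sector y (reverse A₁) A₂ ∷ sector u [] C₁ ∷ sector x C₂ Q ∷ [])
      perm = ↭-trans
        (solve 9 (λ q ν α₁ ψ α₂ υ γ₁ ξ γ₂ →
            q ⊕ ν ⊕ (α₁ ⊕ ψ ⊕ α₂) ⊕ υ ⊕ (γ₁ ⊕ ξ ⊕ γ₂) ⊜ (ν ⊕ ψ ⊕ υ ⊕ ξ) ⊕ α₁ ⊕ α₂ ⊕ γ₁ ⊕ γ₂ ⊕ q ⊕ ∅)
          ↭-refl Q [ v ] A₁ [ y ] A₂ [ u ] C₁ [ x ] C₂)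
        (Permₚ.++⁺ˡ (v ∷ y ∷ u ∷ x ∷ []) (Permₚ.++⁺ʳ _ (↭-sym (Permₚ.↭-reverse A₁))))

-- Counting edges

EdgePair : ∀ {n} → Graph n → Fin n × Fin n → Set
EdgePair G (u , v) = Fin._<_ u v × Adj G u v

edgePair? : ∀ {n} (G : Graph n) e → Dec (EdgePair G e)
edgePair? G (u , v) with u <? v | adj G u v Boolₚ.≟ true
... | yes p | yes e = yes (p , e)
... | yes _ | no ¬e = no (¬e ∘ proj₂)
... | no ¬p | _     = no (¬p ∘ proj₁)

edgeList : ∀ {n} → Graph n → List (Fin n × Fin n)
edgeList {n} G = filter (edgePair? G) (cartesianProduct (allFin n) (allFin n))

indicator : {A : Set} → Dec A → ℕ
indicator d = if does d then 1 else 0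

length-filter-map : ∀ {A B : Set} {P : B → Set} (P? : ∀ b → Dec (P b)) (g : A → B) xs →
  length (filter P? (map g xs)) ≡ sum (map (λ x → indicator (P? (g x))) xs)
length-filter-map P? g []       = refl
length-filter-map P? g (x ∷ xs) with P? (g x)
... | yes _ = cong suc (length-filter-map P? g xs)
... | no _  = length-filter-map P? g xs

length-filter-product : ∀ {A : Set} {P : A × A → Set} (P? : ∀ e → Dec (P e)) xs ys →
  length (filter P? (cartesianProduct xs ys)) ≡
  sum (map (λ x → sum (map (λ y → indicator (P? (x , y))) ys)) xs)
length-filter-product P? []       ys = refl
length-filter-product P? (x ∷ xs) ys = begin
  length (filter P? (map (x ,_) ys ++ cartesianProduct xs ys))
    ≡⟨ cong length (Listₚ.filter-++ P? (map (x ,_) ys) (cartesianProduct xs ys)) ⟩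
  length (filter P? (map (x ,_) ys) ++ filter P? (cartesianProduct xs ys))
    ≡⟨ Listₚ.length-++ (filter P? (map (x ,_) ys)) ⟩
  length (filter P? (map (x ,_) ys)) + length (filter P? (cartesianProduct xs ys))
    ≡⟨ cong₂ _+_ (length-filter-map P? (x ,_) ys) (length-filter-product P? xs ys) ⟩
  _ ∎
  where open ≡-Reasoning

-- The left-hand side of edgeAt-indicator is a function local to edgeCount and cannot be named.
mutual
  edgeCount≡length : ∀ {n} (G : Graph n) → edgeCount G ≡ length (edgeList G)
  edgeCount≡length {n} G = trans
    (cong sum (Listₚ.map-cong (λ u → cong sum (Listₚ.map-cong (λ v →
      edgeAt-indicator G u v) (allFin n))) (allFin n)))
    (sym (length-filter-product (edgePair? G) (allFin n) (allFin n)))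

  edgeAt-indicator : ∀ {n} (G : Graph n) u v → _ ≡ indicator (edgePair? G (u , v))
  edgeAt-indicator G u v with u <? v | adj G u v Boolₚ.≟ true
  ... | yes _ | yes e rewrite e              = refl
  ... | yes _ | no ¬e rewrite Boolₚ.¬-not ¬e = refl
  ... | no _  | _                            = refl

module _ {n : ℕ} (G : Graph n) where

  edgeList-unique : Unique (edgeList G)
  edgeList-unique = Uniqueₚ.filter⁺ (edgePair? G)
    (Uniqueₚ.cartesianProduct⁺ (Uniqueₚ.allFin⁺ n) (Uniqueₚ.allFin⁺ n))

  ∈-edgeList : ∀ {u v} → Fin._<_ u v → Adj G u v → (u , v) ∈ edgeList G
  ∈-edgeList {u} {v} u<v e = ∈-filter⁺ (edgePair? G) (∈-cartesianProduct⁺ (∈-allFin u) (∈-allFin v)) (u<v , e)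

  edgeList-edge : ∀ i → EdgePair G (lookup (edgeList G) i)
  edgeList-edge i = proj₂ (∈-filter⁻ (edgePair? G) {xs = cartesianProduct (allFin n) (allFin n)} (∈-lookup i))

  ordered : ∀ {u v} → Adj G u v → ∃ λ e → e ∈ edgeList G × Ends u v (proj₁ e) (proj₂ e)
  ordered {u} {v} e with Finₚ.<-cmp u v
  ... | tri< u<v _ _  = _ , ∈-edgeList u<v e , inj₁ (refl , refl)
  ... | tri≈ _ u≡v _  = ⊥-elim (adj-irrefl G e u≡v)
  ... | tri> _ _ v<u  = _ , ∈-edgeList v<u (adj-sym G e) , inj₂ (refl , refl)

  -- Each edge is sent to a thread joining its ends. Since `edgeList` holds every edge once, smaller
  -- end first, the unordered ends of the thread determine the edge, and the map is injective.
  edgeCount≤ : ∀ T → Adj G ⇒ KAdj T → edgeCount G ≤ length T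
  edgeCount≤ T cover = subst (_≤ length T) (sym (edgeCount≡length G)) (injective⇒≤ {f = place} inj)
    where
    member : ∀ i → KAdj T (proj₁ (lookup (edgeList G) i)) (proj₂ (lookup (edgeList G) i))
    member i = cover (proj₂ (edgeList-edge i))
    place : Fin (length (edgeList G)) → Fin (length T)
    place i = Any.index (member i)
    same : ∀ {a b u v u′ v′ : Fin n} → Ends a b u v → Ends a b u′ v′ →
      Fin._<_ u v → Fin._<_ u′ v′ → (u , v) ≡ (u′ , v′)
    same (inj₁ (refl , refl)) (inj₁ (refl , refl)) _ _ = refl
    same (inj₂ (refl , refl)) (inj₂ (refl , refl)) _ _ = refl
    same (inj₁ (refl , refl)) (inj₂ (refl , refl)) p q = ⊥-elim (ℕₚ.<-asym p q)
    same (inj₂ (refl , refl)) (inj₁ (refl , refl)) p q = ⊥-elim (ℕₚ.<-asym p q)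
    inj : ∀ {i j} → place i ≡ place j → i ≡ j
    inj {i} {j} eq = lookup-injective edgeList-unique i j
      (same (Anyₚ.lookup-index (member i))
        (subst (λ k → Ends (src (lookup T k)) (tgt (lookup T k)) _ _) (sym eq) (Anyₚ.lookup-index (member j)))
        (proj₁ (edgeList-edge i)) (proj₁ (edgeList-edge j)))

  edgeCount≥ : ∀ {k} (a b : Fin k → Fin n) → (∀ i → Adj G (a i) (b i)) →
    (∀ i j → Ends (a i) (b i) (a j) (b j) → i ≡ j) → k ≤ edgeCount G
  edgeCount≥ {k} a b e distinct = subst (k ≤_) (sym (edgeCount≡length G)) (injective⇒≤ {f = place} inj)
    where
    place : Fin k → Fin (length (edgeList G))
    place i = Any.index (proj₁ (proj₂ (ordered (e i))))
    compare : ∀ {a b c d p q : Fin n} → Ends a b p q → Ends c d p q → Ends a b c d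
    compare (inj₁ (refl , refl)) (inj₁ (refl , refl)) = inj₁ (refl , refl)
    compare (inj₁ (refl , refl)) (inj₂ (refl , refl)) = inj₂ (refl , refl)
    compare (inj₂ (refl , refl)) (inj₁ (refl , refl)) = inj₂ (refl , refl)
    compare (inj₂ (refl , refl)) (inj₂ (refl , refl)) = inj₁ (refl , refl)
    inj : ∀ {i j} → place i ≡ place j → i ≡ j
    inj {i} {j} eq with ordered (e i) | ordered (e j)
    ... | x , x∈ , ex | y , y∈ , ey = distinct i j (compare ex
      (subst (λ z → Ends (a j) (b j) (proj₁ z) (proj₂ z))
        (trans (Anyₚ.lookup-index y∈)
          (trans (cong (lookup (edgeList G)) (sym eq)) (sym (Anyₚ.lookup-index x∈)))) ey))

-- Cyclic successors and the edges of a wheel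

CyclicSucc : ∀ {m} → Fin m → Fin m → Set
CyclicSucc {m} i j = toℕ j ≡ suc (toℕ i) ⊎ (toℕ j ≡ 0 × suc (toℕ i) ≡ m)

rimNext⁺ : ∀ {m} {i j : Fin m} → CyclicSucc i j → rimNext i j ≡ true
rimNext⁺ {m} {i} {j} s with toℕ j ℕₚ.≟ suc (toℕ i)
... | yes _ = refl
... | no ¬p with s
...   | inj₁ p = ⊥-elim (¬p p)
...   | inj₂ (z , w) with toℕ j | suc (toℕ i) ℕₚ.≟ m
...     | zero | yes _ = refl
...     | zero | no ¬w = ⊥-elim (¬w w)

rimNext⁻ : ∀ {m} {i j : Fin m} → rimNext i j ≡ true → CyclicSucc i j
rimNext⁻ {m} {i} {j} e with toℕ j ℕₚ.≟ suc (toℕ i)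
... | yes p = inj₁ p
... | no _ with toℕ j | suc (toℕ i) ℕₚ.≟ m
...   | zero | yes w = inj₂ (refl , w)

cyclic-succ-unique : ∀ {m} {i j k : Fin m} → CyclicSucc i j → CyclicSucc i k → j ≡ k
cyclic-succ-unique (inj₁ p) (inj₁ q) = toℕ-injective (trans p (sym q))
cyclic-succ-unique (inj₂ (p , _)) (inj₂ (q , _)) = toℕ-injective (trans p (sym q))
cyclic-succ-unique {j = j} (inj₁ p) (inj₂ (_ , w)) = ⊥-elim (ℕₚ.<-irrefl (trans p w) (toℕ<n j))
cyclic-succ-unique {k = k} (inj₂ (_ , w)) (inj₁ p) = ⊥-elim (ℕₚ.<-irrefl (trans p w) (toℕ<n k))

cyclic-succ-exists : ∀ {m} (i : Fin m) → ∃ λ j → CyclicSucc i j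
cyclic-succ-exists {suc m} i with suc (toℕ i) ℕₚ.≟ suc m
... | yes w = zero , inj₂ (refl , w)
... | no ¬w = fromℕ< i<m , inj₁ (Finₚ.toℕ-fromℕ< i<m)
  where
  i<m : suc (toℕ i) < suc m
  i<m = ℕₚ.≤∧≢⇒< (toℕ<n i) ¬w

-- On a rim of two vertices each would succeed the other, and the two rim edges would coincide;
-- three vertices exclude this.
cyclic-succ-asym : ∀ {m} {i j : Fin m} → 3 ≤ m → CyclicSucc i j → CyclicSucc j i → ⊥
cyclic-succ-asym 3≤ (inj₁ p) (inj₁ q) =
  ℕₚ.<-asym (ℕₚ.≤-reflexive (sym p)) (ℕₚ.≤-reflexive (sym q))
cyclic-succ-asym 3≤ (inj₁ p) (inj₂ (q , w)) =
  ℕₚ.<⇒≱ 3≤ (ℕₚ.≤-reflexive (trans (sym w) (cong suc (trans p (cong suc q)))))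
cyclic-succ-asym 3≤ (inj₂ (p , w)) (inj₁ q) =
  ℕₚ.<⇒≱ 3≤ (ℕₚ.≤-reflexive (trans (sym w) (cong suc (trans q (cong suc p)))))
cyclic-succ-asym 3≤ (inj₂ (p , w)) (inj₂ (q , w′)) =
  ℕₚ.<⇒≱ 3≤ (ℕₚ.≤-trans (ℕₚ.≤-reflexive (trans (sym w) (cong suc q))) (s≤s z≤n))

-- Half of the indices name the spokes, the other half the rim edges towards the successor. Distinct
-- rim edges could agree only in opposite directions. A lower count suffices, since the general
-- bound supplies the upper one.
wheel-edges≥ : ∀ {m} (G : Graph (suc m)) → IsWheel≥3 G → m + m ≤ edgeCount G
wheel-edges≥ {m} G (3≤ , iso) = edgeCount≥ G (from ∘ proj₁ ∘ spec) (from ∘ proj₂ ∘ spec) edges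
  (λ i j e → spec-injective i j (pull e))
  where
  open IsoTo iso
  pairs : Fin m ⊎ Fin m → Fin (suc m) × Fin (suc m)
  pairs (inj₁ i) = zero , suc i
  pairs (inj₂ i) = suc i , suc (proj₁ (cyclic-succ-exists i))
  spec : Fin (m + m) → Fin (suc m) × Fin (suc m)
  spec k = pairs (Fin.splitAt m k)
  from-injective : ∀ {x y} → from x ≡ from y → x ≡ y
  from-injective {x} {y} eq = trans (sym (to-from x)) (trans (cong to eq) (to-from y))
  pull : ∀ {x y u v} → Ends (from x) (from y) (from u) (from v) → Ends x y u v
  pull (inj₁ (p , q)) = inj₁ (from-injective p , from-injective q)
  pull (inj₂ (p , q)) = inj₂ (from-injective p , from-injective q)
  wheel-edge : ∀ k → wheelAdj (proj₁ (pairs k)) (proj₂ (pairs k)) ≡ true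
  wheel-edge (inj₁ i) = refl
  wheel-edge (inj₂ i) = let (j , s) = cyclic-succ-exists i in cong (_∨ rimNext j i) (rimNext⁺ s)
  edges : ∀ k → Adj G (from (proj₁ (spec k))) (from (proj₂ (spec k)))
  edges k = trans (preserves _ _)
    (trans (cong₂ wheelAdj (to-from _) (to-from _)) (wheel-edge (Fin.splitAt m k)))
  pairs-injective : ∀ k l →
    Ends (proj₁ (pairs k)) (proj₂ (pairs k)) (proj₁ (pairs l)) (proj₂ (pairs l)) → k ≡ l
  pairs-injective (inj₁ i) (inj₁ .i) (inj₁ (_ , refl)) = refl
  pairs-injective (inj₁ i) (inj₂ j)  (inj₁ (() , _))
  pairs-injective (inj₁ i) (inj₂ j)  (inj₂ (_ , ()))
  pairs-injective (inj₂ i) (inj₁ j)  (inj₁ (() , _))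
  pairs-injective (inj₂ i) (inj₁ j)  (inj₂ (() , _))
  pairs-injective (inj₂ i) (inj₂ .i) (inj₁ (refl , _)) = refl
  pairs-injective (inj₂ i) (inj₂ j)  (inj₂ (p , q)) = ⊥-elim (cyclic-succ-asym 3≤
    (subst (CyclicSucc i) (sym (Finₚ.suc-injective p)) (proj₂ (cyclic-succ-exists i)))
    (subst (CyclicSucc j) (Finₚ.suc-injective q) (proj₂ (cyclic-succ-exists j))))
  spec-injective : ∀ i j → Ends (proj₁ (spec i)) (proj₂ (spec i)) (proj₁ (spec j)) (proj₂ (spec j)) → i ≡ j
  spec-injective i j e = trans (sym (Finₚ.join-splitAt m m i))
    (trans (cong (Fin.join m m) (pairs-injective (Fin.splitAt m i) (Fin.splitAt m j) e)) (Finₚ.join-splitAt m m j))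

-- Recognising wheels

module _ {n : ℕ} where

  -- The cyclic successor in list form; it mediates between the recursion of `wheelFrom` and the
  -- index arithmetic of `rimNext`.
  after : Fin n → (rs : List (Fin n)) → Fin (length rs) → Fin n
  after z (r ∷ [])      zero    = z
  after z (r ∷ r′ ∷ _)  zero    = r′
  after z (r ∷ r′ ∷ rs) (suc i) = after z (r′ ∷ rs) i

  after-spec : ∀ z rs i → (∃ λ j → toℕ j ≡ suc (toℕ i) × after z rs i ≡ lookup rs j)
    ⊎ (suc (toℕ i) ≡ length rs × after z rs i ≡ z)
  after-spec z (r ∷ [])      zero    = inj₂ (refl , refl)
  after-spec z (r ∷ r′ ∷ rs) zero    = inj₁ (suc zero , refl , refl)
  after-spec z (r ∷ r′ ∷ rs) (suc i) with after-spec z (r′ ∷ rs) i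
  ... | inj₁ (j , p , q) = inj₁ (suc j , cong suc p , q)
  ... | inj₂ (p , q)     = inj₂ (cong suc p , q)

  after-cyclic : ∀ r rs i → ∃ λ j → CyclicSucc i j × after r (r ∷ rs) i ≡ lookup (r ∷ rs) j
  after-cyclic r rs i with after-spec r (r ∷ rs) i
  ... | inj₁ (j , p , q) = j , inj₁ p , q
  ... | inj₂ (p , q)     = zero , inj₂ (refl , p) , q

  wheelFrom-edge⁻ : ∀ (h z : Fin n) ss {u v} → KAdj (wheelFrom h z ss) u v →
    ∃ λ i → Ends (lookup (map rim ss) i) h u v ⊎ Ends (lookup (map rim ss) i) (after z (map rim ss) i) u v
  wheelFrom-edge⁻ h z (s ∷ ss)      (here e)                 = zero , inj₁ e
  wheelFrom-edge⁻ h z (s ∷ [])      (there (here e))         = zero , inj₂ e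
  wheelFrom-edge⁻ h z (s ∷ s′ ∷ ss) (there (here e))         = zero , inj₂ e
  wheelFrom-edge⁻ h z (s ∷ s′ ∷ ss) (there (there e))        =
    let (i , p) = wheelFrom-edge⁻ h z (s′ ∷ ss) e in suc i , p

  arc-edge : ∀ (h z : Fin n) ss i → KAdj (wheelFrom h z ss) (lookup (map rim ss) i) (after z (map rim ss) i)
  arc-edge h z (s ∷ [])      zero    = there (here (inj₁ (refl , refl)))
  arc-edge h z (s ∷ s′ ∷ ss) zero    = there (here (inj₁ (refl , refl)))
  arc-edge h z (s ∷ s′ ∷ ss) (suc i) = there (there (arc-edge h z (s′ ∷ ss) i))

  wheelAdj⇒kadj : ∀ (h : Fin n) ss x y → wheelAdj x y ≡ true →
    KAdj (wheelThreads h ss) (lookup (branches h ss) x) (lookup (branches h ss) y)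
  wheelAdj⇒kadj h ss        zero    (suc j) e = kadj-sym (spoke-edge h _ ss (∈-lookup j))
  wheelAdj⇒kadj h ss        (suc i) zero    e = spoke-edge h _ ss (∈-lookup i)
  wheelAdj⇒kadj h ss@(s ∷ ss′) (suc i) (suc j) e =
    [ arc-along i j , (λ e′ → kadj-sym (arc-along j i e′)) ]′ (∨-true (rimNext i j) e)
    where
    ∨-true : ∀ b {c} → b ∨ c ≡ true → b ≡ true ⊎ c ≡ true
    ∨-true true  _ = inj₁ refl
    ∨-true false e = inj₂ e
    arc-along : ∀ i j → rimNext i j ≡ true →
      KAdj (wheelThreads h ss) (lookup (map rim ss) i) (lookup (map rim ss) j)
    arc-along i j e with after-cyclic (rim s) (map rim ss′) i
    ... | k , ik , eq rewrite cyclic-succ-unique (rimNext⁻ {i = i} {j} e) ik =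
      subst (KAdj (wheelThreads h ss) (lookup (map rim ss) i)) eq (arc-edge h (rim s) ss i)

  kadj⇒wheelAdj : ∀ (h : Fin n) ss → Unique (branches h ss) → ∀ x y →
    KAdj (wheelThreads h ss) (lookup (branches h ss) x) (lookup (branches h ss) y) → wheelAdj x y ≡ true
  kadj⇒wheelAdj h ss@(s ∷ ss′) uq x y e with wheelFrom-edge⁻ h (rim s) ss e
  ... | i , inj₁ (inj₁ (p , q)) with lookup-injective uq x (suc i) p | lookup-injective uq y zero q
  ...   | refl | refl = refl
  kadj⇒wheelAdj h ss@(s ∷ ss′) uq x y e | i , inj₁ (inj₂ (p , q))
    with lookup-injective uq x zero p | lookup-injective uq y (suc i) q
  ...   | refl | refl = refl
  kadj⇒wheelAdj h ss@(s ∷ ss′) uq x y e | i , inj₂ ends with after-cyclic (rim s) (map rim ss′) i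
  kadj⇒wheelAdj h ss@(s ∷ ss′) uq x y e | i , inj₂ (inj₁ (p , q)) | j , ij , eq
    with lookup-injective uq x (suc i) p | lookup-injective uq y (suc j) (trans q eq)
  ...   | refl | refl = cong (_∨ rimNext j i) (rimNext⁺ ij)
  kadj⇒wheelAdj h ss@(s ∷ ss′) uq x y e | i , inj₂ (inj₂ (p , q)) | j , ij , eq
    with lookup-injective uq x (suc j) (trans p eq) | lookup-injective uq y (suc i) q
  ...   | refl | refl = trans (cong (rimNext j i ∨_) (rimNext⁺ ij)) (Boolₚ.∨-zeroʳ (rimNext j i))

wheelAdj-cast : ∀ {l m} (eq : l ≡ m) x y →
  wheelAdj (cast (cong suc eq) x) (cast (cong suc eq) y) ≡ wheelAdj x y
wheelAdj-cast refl x y = cong₂ wheelAdj (Finₚ.cast-is-id refl x) (Finₚ.cast-is-id refl y)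

module _ {m : ℕ} {G : Graph (suc m)} {h : Fin (suc m)} {ss : List (Sector (suc m))}
         (w : Wheel G h ss) (tr : Trivial (wheelThreads h ss))
         (sm : SuperMinimallyKConnected 3 G) where

  private
    F = wheel-frame w
    uq : Unique (branches h ss)
    uq = unique-++⁻ˡ (branches h ss) (Wheel.distinct w)
    span : ∀ v → v ∈ branches h ss
    span = spanning F tr sm
    -- The branch vertices are distinct and, by minimality, exhaust `Fin (suc m)`. The equation is
    -- only propositional, so the isomorphism passes through `cast`.
    size : length (map rim ss) ≡ m
    size = ℕₚ.suc-injective (ℕₚ.≤-antisym (branch-bound F)
      (subst (_≤ length (branches h ss)) (Listₚ.length-tabulate id)
        (unique-⊆-length {xs = allFin (suc m)} (Uniqueₚ.allFin⁺ (suc m)) (λ {v} _ → span v))))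

    size′ : suc (length (map rim ss)) ≡ suc m
    size′ = cong suc size

    position : Fin (suc m) → Fin (suc (length (map rim ss)))
    position v = Any.index (span v)

    at-position : ∀ v → v ≡ lookup (branches h ss) (position v)
    at-position v = Anyₚ.lookup-index (span v)

    position-at : ∀ i → position (lookup (branches h ss) i) ≡ i
    position-at i = lookup-injective uq _ _ (sym (at-position _))

  trivial-wheel⇒wheel : IsWheel≥3 G
  trivial-wheel⇒wheel = subst (3 ≤_) (trans (sym (Listₚ.length-map rim ss)) size) (Wheel.size w) , record
    { to        = λ v → cast size′ (position v)
    ; from      = λ i → lookup (branches h ss) (cast (sym size′) i)
    ; to-from   = λ i → trans (cong (cast size′) (position-at (cast (sym size′) i)))
                    (trans (Finₚ.cast-trans (sym size′) size′ i) (Finₚ.cast-is-id refl i))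
    ; from-to   = λ v → trans (cong (lookup (branches h ss))
                    (trans (Finₚ.cast-trans size′ (sym size′) (position v)) (Finₚ.cast-is-id refl (position v))))
                    (sym (at-position v))
    ; preserves = λ u v → trans (same u v) (sym (wheelAdj-cast size (position u) (position v)))
    }
    where
    K = wheelThreads h ss
    same : ∀ u v → adj G u v ≡ wheelAdj (position u) (position v)
    same u v = Boolₚ.⇔→≡ (mk⇔
      (λ e → kadj⇒wheelAdj h ss uq (position u) (position v)
        (subst₂ (KAdj K) (at-position u) (at-position v) (adj⇒kadj F tr sm e)))
      (λ e → kadj⇒adj (Frame.good F) tr
        (subst₂ (KAdj K) (sym (at-position u)) (sym (at-position v))
          (wheelAdj⇒kadj h ss (position u) (position v) e))))

  trivial-wheel-edges≤ : edgeCount G ≤ 2 * suc m ∸ 2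
  trivial-wheel-edges≤ = ℕₚ.m+n≤o⇒m≤o∸n (edgeCount G) (begin
    edgeCount G + 2              ≤⟨ ℕₚ.+-monoˡ-≤ 2 (edgeCount≤ G (wheelThreads h ss) (adj⇒kadj F tr sm)) ⟩
    length (wheelThreads h ss) + 2 ≤⟨ Frame.slack F ⟩
    2 * length (branches h ss)   ≤⟨ ℕₚ.*-monoʳ-≤ 2 (branch-bound F) ⟩
    2 * suc m                    ∎)
    where open ℕₚ.≤-Reasoning

-- The bound and the case of equality

strict-edges : ∀ {n} {G : Graph n} {B T} → SuperMinimallyKConnected 3 G → Frame G B T 3 →
  edgeCount G + 3 ≤ 2 * n
strict-edges {n} {G} {B} {T} sm F with saturate (proj₁ sm) n (length T) (ℕₚ.m≤m+n n (length B)) ℕₚ.≤-refl F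
... | B′ , T′ , F′ , tr = begin
  edgeCount G + 3  ≤⟨ ℕₚ.+-monoˡ-≤ 3 (edgeCount≤ G T′ (adj⇒kadj F′ tr sm)) ⟩
  length T′ + 3    ≤⟨ Frame.slack F′ ⟩
  2 * length B′    ≤⟨ ℕₚ.*-monoʳ-≤ 2 (branch-bound F′) ⟩
  2 * n            ∎
  where open ℕₚ.≤-Reasoning

2*suc∸2 : ∀ m → 2 * suc m ∸ 2 ≡ m + m
2*suc∸2 m = trans (cong (_∸ 2) (ℕₚ.*-suc 2 m)) (cong (m +_) (ℕₚ.+-identityʳ m))

theorem1p12 : ∀ (n : ℕ) (G : Graph n) → SuperMinimallyKConnected 3 G →
    (edgeCount G ≤ 2 * n ∸ 2) ×
    ((edgeCount G ≡ 2 * n ∸ 2 → IsWheel≥3 G) × (IsWheel≥3 G → edgeCount G ≡ 2 * n ∸ 2))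
theorem1p12 zero G ((() , _) , _)
theorem1p12 (suc m) G sm = bound , equality , λ isW → ℕₚ.≤-antisym bound
  (subst (_≤ edgeCount G) (sym (2*suc∸2 m)) (wheel-edges≥ G isW))
  where
  dichotomy : WheelIn ⊎ Strict
  dichotomy = let (h , ss , w) = initial-wheel (proj₁ sm)
              in wheel-or-strict (proj₁ sm) (suc m) (ℕₚ.m≤m+n (suc m) (length ss)) w
  strict : Strict {G = G} → edgeCount G < 2 * suc m ∸ 2
  strict (_ , _ , F) = ℕₚ.m+n≤o⇒m≤o∸n (suc (edgeCount G))
    (subst (_≤ 2 * suc m) (ℕₚ.+-suc (edgeCount G) 2) (strict-edges sm F))
  bound : edgeCount G ≤ 2 * suc m ∸ 2
  bound with dichotomy
  ... | inj₁ (h , ss , w , tr) = trivial-wheel-edges≤ w tr sm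
  ... | inj₂ st = ℕₚ.<⇒≤ (strict st)
  equality : edgeCount G ≡ 2 * suc m ∸ 2 → IsWheel≥3 G
  equality eq with dichotomy
  ... | inj₁ (h , ss , w , tr) = trivial-wheel⇒wheel w tr sm
  ... | inj₂ st = ⊥-elim (ℕₚ.<-irrefl eq (strict st))
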